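{- Every $2$-uniform projective Hjelmslev plane can be generated by Algorithm 1 (described in the context); that is, it is isomorphic to an incidence structure produced by Algorithm 1 from some projective plane $\mathcal{P}$ of some order $m$, some affine planes $\mathcal{A}_P$ of order $m$ (one for each point $P$ of $\mathcal{P}$), some orthogonal arrays $\mathcal{O}_l=OA(2,m+1,m)$ (one for each line $l$ of $\mathcal{P}$), and some admissible choices in the algorithm.
   Context: An orthogonal array $OA(2,k,v)$ is a $v^2\times k$ array with entries from a set of $v$ symbols such that in any $2$ columns each ordered pair of symbols occurs exactly once. An affine plane of order $m$ has $m^2$ points, $m$ points per line, and its lines fall into $m+1$ parallel classes of $m$ pairwise disjoint lines each; a projective plane of order $m$ has $m^2+m+1$ points and lines, $m+1$ points on each line and $m+1$ lines through each point. Algorithm 1. Input: a projective plane $\mathcal{P}$ of order $m$, an affine plane $\mathcal{A}_P$ of order $m$ for each point $P$ of $\mathcal{P}$, an $OA(2,m+1,m)$ $\mathcal{O}_l$ for each line $l$ of $\mathcal{P}$. Points of $\mathcal{H}$: all pairs $(P,x)$ with $P$ a point of $\mathcal{P}$ and $x$ a point of $\mathcal{A}_P$. For each line $l=\{P_0,\dots,P_m\}$ of $\mathcal{P}$: for each $P_i\in l$ choose a parallel class $\pi_{l,P_i}$ of $\mathcal{A}_{P_i}$, so that for each point $P$ the lines of $\mathcal{P}$ through $P$ receive pairwise distinct parallel classes of $\mathcal{A}_P$; choose a bijection between the columns of $\mathcal{O}_l$ and the points of $l$, and for each $i$ a bijection between the $m$ symbols of $\mathcal{O}_l$ and the lines of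 $\pi_{l,P_i}$. For each row $r$ of $\mathcal{O}_l$, form the line of $\mathcal{H}$ consisting of all $(P_i,x)$, $i=0,\dots,m$, such that $x$ lies on the line of $\pi_{l,P_i}$ labelled by the entry of $\mathcal{O}_l$ in row $r$ and the column corresponding to $P_i$. The lines of $\mathcal{H}$ are all lines so formed over all $l$; incidence is membership. A projective Hjelmslev plane is an incidence structure $\mathcal{H}$ together with an epimorphism $\phi$ (incidence-preserving, surjective on points and lines) onto an ordinary projective plane such that: (1) any two points lie on at least one common line; (2) any two lines have at least one common point; (3) if two lines meet in more than one point they have the same image under $\phi$; (4) if two points lie on more than one common line they have the same image under $\phi$. Points (lines) are neighbours, $P\sim Q$, iff they have the same image under $\phi$. For a point $P$, the point-neighbourhood restriction $\bar P$ has as points the points $Q\sim P$ and as lines the nonempty sets $g\cap\bar P$, $g$ a line of $\mathcal{H}$. The plane is $2$-uniform if for every point $P$, $\bar P$ is an ordinary affine plane and every line of $\bar P$ is the restriction $g\cap\bar P$ of the same number of lines $g$ of $\mathcal{H}$.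
   Formalization: The plane is assumed finite: an infinite 2-uniform plane, such as the one over ℝ[ε]/(ε²), cannot be an output of Algorithm 1, which is always finite. Lines are also assumed to be determined by their points, which follows from axiom (4). -}

module Defs where

open import Data.Nat using (ℕ; suc; _+_; _*_)
open import Data.Fin using (Fin)
open import Data.Product using (Σ; Σ-syntax; _×_; _,_; proj₁; proj₂)
open import Data.Unit using (⊤)
open import Data.Sum using (_⊎_)
open import Relation.Nullary using (¬_)
open import Relation.Binary.PropositionalEquality using (_≡_; _≢_)
open import Function.Bundles using (_↔_; Inverse)

IsEnumOf : {A : Set} → (A → Set) → {k : ℕ} → (Fin k → A) → Set
IsEnumOf {A} P {k} e =
  (∀ i j → e i ≡ e j → i ≡ j) × (∀ i → P (e i)) × (∀ a → P a → Σ[ i ∈ Fin k ] e i ≡ a)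

ExactlyOf : {A : Set} → (A → Set) → ℕ → Set
ExactlyOf {A} P k = Σ[ e ∈ (Fin k → A) ] IsEnumOf P e

record IncStr : Set₁ where
  constructor mkInc
  field
    Point : Set
    Line  : Set
    _I_   : Point → Line → Set



Finite : IncStr → Set
Finite S = Σ[ p ∈ ℕ ] ExactlyOf (λ (_ : IncStr.Point S) → ⊤) p
         × Σ[ b ∈ ℕ ] ExactlyOf (λ (_ : IncStr.Line S) → ⊤) b

module _ (S : IncStr) where
  open IncStr S renaming (_I_ to _∈ₛ_)

  SamePts : Line → Line → Set
  SamePts L L' = ∀ x → (x ∈ₛ L → x ∈ₛ L') × (x ∈ₛ L' → x ∈ₛ L)

  Parallel : Line → Line → Set
  Parallel L L' = SamePts L L' ⊎ (∀ x → ¬ (x ∈ₛ L × x ∈ₛ L'))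

  Collinear : Point → Point → Point → Set
  Collinear x y z = Σ[ L ∈ Line ] (x ∈ₛ L × y ∈ₛ L × z ∈ₛ L)

  record IsAffinePlane : Set where
    field
      lineHasTwoPts : ∀ L → Σ[ x ∈ Point ] Σ[ y ∈ Point ] (x ≢ y × x ∈ₛ L × y ∈ₛ L)
      join     : ∀ x y → x ≢ y →
                 Σ[ L ∈ Line ] (x ∈ₛ L × y ∈ₛ L × (∀ L' → x ∈ₛ L' → y ∈ₛ L' → SamePts L L'))
      playfair : ∀ x L →
                 Σ[ L' ∈ Line ] (x ∈ₛ L' × Parallel L L'
                   × (∀ L'' → x ∈ₛ L'' → Parallel L L'' → SamePts L' L''))
      nondeg   : Σ[ x ∈ Point ] Σ[ y ∈ Point ] Σ[ z ∈ Point ] ¬ Collinear x y z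

  record IsProjectivePlane : Set where
    field
      join   : ∀ P Q → P ≢ Q →
               Σ[ l ∈ Line ] (P ∈ₛ l × Q ∈ₛ l × (∀ l' → P ∈ₛ l' → Q ∈ₛ l' → l' ≡ l))
      meet   : ∀ l l' → l ≢ l' →
               Σ[ P ∈ Point ] (P ∈ₛ l × P ∈ₛ l' × (∀ P' → P' ∈ₛ l → P' ∈ₛ l' → P' ≡ P))
      nondeg : Σ[ P ∈ Point ] Σ[ Q ∈ Point ] Σ[ R ∈ Point ] Σ[ T ∈ Point ]
               (¬ Collinear P Q R × ¬ Collinear P Q T × ¬ Collinear P R T × ¬ Collinear Q R T)

  IsParallelClassLabelling : {m : ℕ} → (Fin m → Line) → Set
  IsParallelClassLabelling {m} lab =
    (∀ s t → lab s ≡ lab t → s ≡ t)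
    × (∀ s t → Parallel (lab s) (lab t))
    × (∀ L s → Parallel L (lab s) → Σ[ t ∈ Fin m ] lab t ≡ L)

record Epi (H Π : IncStr) : Set where
  field
    fp     : IncStr.Point H → IncStr.Point Π
    fl     : IncStr.Line H → IncStr.Line Π
    fpSurj : ∀ y → Σ[ x ∈ IncStr.Point H ] fp x ≡ y
    flSurj : ∀ y → Σ[ g ∈ IncStr.Line H ] fl g ≡ y
    pres   : ∀ x g → IncStr._I_ H x g → IncStr._I_ Π (fp x) (fl g)

record IsPHP (H Π : IncStr) (φ : Epi H Π) : Set where
  open IncStr H renaming (_I_ to _∈H_)
  open Epi φ
  field
    target : IsProjectivePlane Π
    ax1 : ∀ P Q → Σ[ g ∈ Line ] (P ∈H g × Q ∈H g)
    ax2 : ∀ g h → Σ[ P ∈ Point ] (P ∈H g × P ∈H h)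
    ax3 : ∀ g h P Q → P ≢ Q → P ∈H g → Q ∈H g → P ∈H h → Q ∈H h → fl g ≡ fl h
    ax4 : ∀ P Q g h → g ≢ h → P ∈H g → P ∈H h → Q ∈H g → Q ∈H h → fp P ≡ fp Q

-- point-neighbourhood restriction  P̄  (lines: nonempty g ∩ P̄, represented by g;
-- two representatives denote the same line of P̄ iff they have the same points in P̄)
Nbhd : (H Π : IncStr) → Epi H Π → IncStr.Point H → IncStr
Nbhd H Π φ P =
  mkInc (Σ[ Q ∈ Point ] fp Q ≡ fp P)
        (Σ[ g ∈ Line ] Σ[ Q ∈ Point ] (fp Q ≡ fp P × Q ∈H g))
        (λ Q g → proj₁ Q ∈H proj₁ g)
  where open IncStr H renaming (_I_ to _∈H_)
        open Epi φ

RestrictsTo : (H Π : IncStr) (φ : Epi H Π) (P : IncStr.Point H) →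
              IncStr.Line H → IncStr.Line (Nbhd H Π φ P) → Set
RestrictsTo H Π φ P g L =
  ∀ (Q : IncStr.Point (Nbhd H Π φ P)) →
    (proj₁ Q ∈H g → proj₁ Q ∈H proj₁ L) × (proj₁ Q ∈H proj₁ L → proj₁ Q ∈H g)
  where open IncStr H renaming (_I_ to _∈H_)

TwoUniform : (H Π : IncStr) → Epi H Π → Set
TwoUniform H Π φ =
  ∀ (P : IncStr.Point H) → IsAffinePlane (Nbhd H Π φ P)
    × Σ[ k ∈ ℕ ] (∀ (L : IncStr.Line (Nbhd H Π φ P)) →
                    ExactlyOf (λ g → RestrictsTo H Π φ P g L) k)

record Iso (S T : IncStr) : Set where
  field
    pts : IncStr.Point S ↔ IncStr.Point T
    lns : IncStr.Line S ↔ IncStr.Line T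
    inc : ∀ x g → (IncStr._I_ S x g → IncStr._I_ T (Inverse.to pts x) (Inverse.to lns g))
                × (IncStr._I_ T (Inverse.to pts x) (Inverse.to lns g) → IncStr._I_ S x g)

-- number of points (= lines) of a projective plane of order m
NP : ℕ → ℕ
NP m = m * m + m + 1

AffInc : (m : ℕ) → (Fin (m * m) → Fin (m * m + m) → Set) → IncStr
AffInc m A = mkInc (Fin (m * m)) (Fin (m * m + m)) A

record IsAffinePlaneOfOrder (m : ℕ) (A : Fin (m * m) → Fin (m * m + m) → Set) : Set where
  field
    affine : IsAffinePlane (AffInc m A)
    simple : ∀ L L' → SamePts (AffInc m A) L L' → L ≡ L'
    order  : ∀ L → ExactlyOf (λ x → A x L) m

-- OA(2, m+1, m): rows Fin (m²), columns Fin (m+1), symbols Fin m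
IsOA : (m : ℕ) → (Fin (m * m) → Fin (suc m) → Fin m) → Set
IsOA m O = ∀ j j' → j ≢ j' → ∀ a b →
  Σ[ r ∈ Fin (m * m) ] ((O r j ≡ a × O r j' ≡ b)
     × (∀ r' → O r' j ≡ a → O r' j' ≡ b → r' ≡ r))

record AlgInput (m : ℕ) : Set₁ where
  field
    PI        : Fin (NP m) → Fin (NP m) → Set
    projPlane : IsProjectivePlane (mkInc (Fin (NP m)) (Fin (NP m)) PI)
    projOrder : ∀ l → ExactlyOf (λ P → PI P l) (suc m)
    AI        : Fin (NP m) → Fin (m * m) → Fin (m * m + m) → Set
    affPlanes : ∀ P → IsAffinePlaneOfOrder m (AI P)
    OA        : Fin (NP m) → Fin (m * m) → Fin (suc m) → Fin m
    isOA      : ∀ l → IsOA m (OA l)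
    col       : Fin (NP m) → Fin (suc m) → Fin (NP m)
    colBij    : ∀ l → IsEnumOf (λ P → PI P l) (col l)
    -- parallel class π_{l,P} of 𝒜_P (P = col l j) with a bijection symbols → its lines
    lab       : Fin (NP m) → Fin (suc m) → Fin m → Fin (m * m + m)
    labClass  : ∀ l j → IsParallelClassLabelling (AffInc m (AI (col l j))) (lab l j)
    labDist   : ∀ l l' j j' → l ≢ l' → col l j ≡ col l' j' → ∀ s t →
                ¬ Parallel (AffInc m (AI (col l j))) (lab l j s) (lab l' j' t)

algOutput : {m : ℕ} → AlgInput m → IncStr
algOutput {m} D =
  mkInc (Fin (NP m) × Fin (m * m))
        (Fin (NP m) × Fin (m * m))
        (λ Px lr → Σ[ j ∈ Fin (suc m) ]
            (col (proj₁ lr) j ≡ proj₁ Px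
             × AI (proj₁ Px) (proj₂ Px) (lab (proj₁ lr) j (OA (proj₁ lr) (proj₂ lr) j))))
  where open AlgInput D

-- lines are determined by their point sets (lines are sets of points)
Simple : IncStr → Set
Simple S = ∀ g h → SamePts S g h → g ≡ h

{-# OPTIONS --safe #-}

-- Let n_X be the order of the affine plane of points over X ∈ Π.  Two points over distinct X, Y on
-- a line l of Π have a unique join, so counting such pairs shows that n_X n_Y lines lie over l.
-- Lines of Π have at least three points, hence all n_X equal some m and m² lines lie over each l.
-- Lines of different images through X meet exactly once over X, so parallel restrictions over X
-- have the same image.  If each restriction over X comes from k lines and X is on r lines of Π,
-- counting the lines meeting the neighbourhood of X gives (m² + m) k = r m², so m divides k; a
-- parallel class accounts for m k of the m² lines over one l, so k ≤ m.  Hence k = m, r = m + 1, and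
-- the lines over l restrict at each X on l to exactly one parallel class.  The rows of the
-- orthogonal array of l are the lines over l, and the entry in column X is the restriction over X.
--
-- Nothing is assumed decidable.  Incidence in H turns out to be decidable from the uniformity data.
-- Decidability of the neighbour relation is first used under a double negation to get k ≥ 2; then
-- distinct points are neighbours iff they have at least two joins, which is decidable.
module Submission where

open import Defs
open import Data.Empty using (⊥)
open import Data.Fin using (Fin; zero; suc; punchIn; punchOut; combine; remQuot)
open import Data.Fin.Properties using (any?; all?; injective⇒≤; punchIn-injective; punchInᵢ≢i; punchIn-punchOut; combine-remQuot; remQuot-combine) renaming (_≟_ to _≟F_)
open import Data.Nat using (ℕ; zero; suc; _+_; _*_; _≤_; z≤n; s≤s; _≤?_; NonZero; >-nonZero)
open import Data.Nat.Divisibility using (divides; ∣m+n∣m⇒∣n; ∣⇒≤; m∣m*n)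
open import Data.Nat.Properties using (≤-antisym; ≤-trans; 1+n≰n; +-comm; *-comm; *-assoc; *-cancelʳ-≡; *-cancelˡ-≤; m*n≢0; [m*n]*[o*p]≡[m*o]*[n*p])
open import Data.Product using (Σ; Σ-syntax; _×_; _,_; proj₁; proj₂)
open import Data.Sum using (_⊎_; inj₁; inj₂)
open import Data.Unit using (⊤; tt)
open import Function using (id; _∘_)
open import Function.Bundles using (_↔_; mk↔ₛ′)
open import Relation.Binary.Definitions using (DecidableEquality)
open import Relation.Binary.PropositionalEquality using (_≡_; _≢_; refl; sym; trans; cong; subst; subst₂)
open import Relation.Nullary using (¬_; Dec; yes; no; ¬?; contradiction)
open import Relation.Nullary.Decidable using (map′; decidable-stable; _×-dec_; _⊎-dec_; _→-dec_)

-- Enumerations of finite sets and double counting.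

module Counting where

  -- A system of representatives for `_~_` within `P`. With `_≡_` as the relation this is
  -- `IsEnumOf`, so one greedy construction yields both quotients and subsets.
  Transversal : {A : Set} → (A → Set) → (A → A → Set) → {k : ℕ} → (Fin k → A) → Set
  Transversal P _~_ {k} e =
    (∀ i j → e i ~ e j → i ≡ j) × (∀ i → P (e i)) × (∀ a → P a → Σ[ i ∈ Fin k ] e i ~ a)

  Counted : Set → ℕ → Set
  Counted A n = ExactlyOf (λ (_ : A) → ⊤) n

  module _ {A : Set} {n : ℕ} (fin : Counted A n) where

    abstract
      counted-≟ : DecidableEquality A
      counted-≟ a b with proj₂ (proj₂ (proj₂ fin)) a tt | proj₂ (proj₂ (proj₂ fin)) b tt
      ... | i , refl | j , refl = map′ (cong (proj₁ fin)) (proj₁ (proj₂ fin) i j) (i ≟F j)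

      counted-any? : {P : A → Set} → (∀ a → Dec (P a)) → Dec (Σ A P)
      counted-any? {P} P? = map′ (λ (i , p) → proj₁ fin i , p) back (any? (P? ∘ proj₁ fin))
        where
        back : Σ A P → Σ[ i ∈ Fin n ] P (proj₁ fin i)
        back (a , p) with proj₂ (proj₂ (proj₂ fin)) a tt
        ... | i , refl = i , p

      counted-all? : {P : A → Set} → (∀ a → Dec (P a)) → Dec (∀ a → P a)
      counted-all? {P} P? = map′ there (_∘ proj₁ fin) (all? (P? ∘ proj₁ fin))
        where
        there : (∀ i → P (proj₁ fin i)) → ∀ a → P a
        there p a with proj₂ (proj₂ (proj₂ fin)) a tt
        ... | i , refl = p i

      -- Double-negation shift, valid because `A` is finite. It lets the neighbour relation be
      -- assumed decidable for all pairs at once while a stable statement is proved.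
      counted-¬¬ : {P : A → Set} → (∀ a → ¬ ¬ P a) → ¬ ¬ (∀ a → P a)
      counted-¬¬ {P} ¬¬p ¬all = fins n (¬¬p ∘ proj₁ fin) λ p → ¬all λ a → at p a
        where
        fins : ∀ k {Q : Fin k → Set} → (∀ i → ¬ ¬ Q i) → ¬ ¬ (∀ i → Q i)
        fins zero    q ¬q = ¬q λ ()
        fins (suc k) q ¬q = q zero λ q₀ → fins k (q ∘ suc) λ qₛ → ¬q λ { zero → q₀ ; (suc i) → qₛ i }
        at : (∀ i → P (proj₁ fin i)) → ∀ a → P a
        at p a with proj₂ (proj₂ (proj₂ fin)) a tt
        ... | i , refl = p i

  abstract
    -- Greedy choice: index `zero` is added to the representatives of the later indices exactly when
    -- it satisfies `P` and is related to none of them.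
    transversal-Fin : ∀ n {P : Fin n → Set} {_~_ : Fin n → Fin n → Set} →
      (∀ i → Dec (P i)) → (∀ i j → Dec (i ~ j)) → (∀ i → i ~ i) → (∀ i j → i ~ j → j ~ i) →
      Σ[ k ∈ ℕ ] Σ[ e ∈ (Fin k → Fin n) ] Transversal P _~_ e
    transversal-Fin zero P? ~? ~-refl ~-sym = 0 , (λ ()) , (λ ()) , (λ ()) , (λ ())
    transversal-Fin (suc n) {P} {_~_} P? ~? ~-refl ~-sym
      with transversal-Fin n (P? ∘ suc) (λ i j → ~? (suc i) (suc j)) (~-refl ∘ suc) (λ i j → ~-sym (suc i) (suc j))
    ... | k , e , inj , ok , cov with P? zero
    ... | no ¬p = k , suc ∘ e , inj , ok , cover
      where
      cover : ∀ a → P a → Σ[ i ∈ Fin k ] suc (e i) ~ a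
      cover zero    p = contradiction p ¬p
      cover (suc a) p = cov a p
    ... | yes p with any? (λ i → ~? (suc (e i)) zero)
    ... | yes (i , r) = k , suc ∘ e , inj , ok , λ { zero _ → i , r ; (suc a) q → cov a q }
    ... | no new = suc k , e′ , inj′ , (λ { zero → p ; (suc i) → ok i }) , cover
      where
      e′ : Fin (suc k) → Fin (suc n)
      e′ zero    = zero
      e′ (suc i) = suc (e i)
      inj′ : ∀ i j → e′ i ~ e′ j → i ≡ j
      inj′ zero    zero    r = refl
      inj′ zero    (suc j) r = contradiction (j , ~-sym _ _ r) new
      inj′ (suc i) zero    r = contradiction (i , r) new
      inj′ (suc i) (suc j) r = cong suc (inj i j r)
      cover : ∀ a → P a → Σ[ i ∈ Fin (suc k) ] e′ i ~ a
      cover zero    _ = zero , ~-refl zero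
      cover (suc a) q = let i , r = cov a q in suc i , r

    transversal : ∀ {A : Set} {n} → Counted A n → {P : A → Set} {_~_ : A → A → Set} →
      (∀ a → Dec (P a)) → (∀ a b → Dec (a ~ b)) → (∀ a → a ~ a) → (∀ a b → a ~ b → b ~ a) →
      Σ[ k ∈ ℕ ] Σ[ e ∈ (Fin k → A) ] Transversal P _~_ e
    transversal {A} {n} (f , _ , _ , f-cov) {P} {_~_} P? ~? ~-refl ~-sym
      with transversal-Fin n (P? ∘ f) (λ i j → ~? (f i) (f j)) (~-refl ∘ f) (λ i j → ~-sym (f i) (f j))
    ... | k , e , inj , ok , cov = k , f ∘ e , inj , ok , cover
      where
      cover : ∀ a → P a → Σ[ i ∈ Fin k ] f (e i) ~ a
      cover a p with f-cov a tt
      ... | i , refl = cov i p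

    count : ∀ {A : Set} {n} → Counted A n → {P : A → Set} → (∀ a → Dec (P a)) → Σ[ k ∈ ℕ ] ExactlyOf P k
    count fin P? = transversal fin P? (counted-≟ fin) (λ _ → refl) (λ _ _ → sym)

    counted-Fin : ∀ n → Counted (Fin n) n
    counted-Fin n = id , (λ _ _ → id) , (λ _ → tt) , (λ i _ → i , refl)

    counted-image : ∀ {A B : Set} {n} → Counted A n → DecidableEquality B →
      (f : A → B) → (∀ b → Σ[ a ∈ A ] f a ≡ b) → Σ[ k ∈ ℕ ] Counted B k
    counted-image {A} {B} fin _≟_ f surj
      with transversal fin {P = λ _ → ⊤} (λ _ → yes tt) (λ a a′ → f a ≟ f a′) (λ _ → refl) (λ _ _ → sym)
    ... | k , e , inj , _ , cov = k , f ∘ e , inj , (λ _ → tt) , cover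
      where
      cover : ∀ b → ⊤ → Σ[ i ∈ Fin k ] f (e i) ≡ b
      cover b _ with surj b
      ... | a , refl = cov a tt

  module _ {A : Set} {P : A → Set} {k : ℕ} where

    abstract
      exactly-≤ : ∀ {Q : A → Set} {n} → (∀ a → P a → Q a) → ExactlyOf P k → ExactlyOf Q n → k ≤ n
      exactly-≤ {Q} {n} sub (e , inj , ok , _) (f , _ , _ , cov) = injective⇒≤ {f = g} g-inj
        where
        g : Fin k → Fin n
        g i = proj₁ (cov (e i) (sub _ (ok i)))
        g-inj : ∀ {i j} → g i ≡ g j → i ≡ j
        g-inj {i} {j} eq = inj i j (trans (sym (proj₂ (cov (e i) (sub _ (ok i)))))
          (trans (cong f eq) (proj₂ (cov (e j) (sub _ (ok j))))))

      exactly-⇔ : ∀ {Q : A → Set} → (∀ a → P a → Q a) → (∀ a → Q a → P a) → ExactlyOf P k → ExactlyOf Q k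
      exactly-⇔ to from (e , inj , ok , cov) = e , inj , (λ i → to _ (ok i)) , λ a q → cov a (from a q)

      exactly-dec : DecidableEquality A → ExactlyOf P k → ∀ a → Dec (P a)
      exactly-dec _≟_ (e , _ , ok , cov) a =
        map′ (λ (i , eq) → subst P eq (ok i)) (cov a) (any? (λ i → e i ≟ a))

      exactly-insert : ∀ {a} → ¬ P a → ExactlyOf P k → ExactlyOf (λ x → P x ⊎ x ≡ a) (suc k)
      exactly-insert {a} ¬p (e , inj , ok , cov) = e′ , inj′ , ok′ , cov′
        where
        e′ : Fin (suc k) → A
        e′ zero    = a
        e′ (suc i) = e i
        inj′ : ∀ i j → e′ i ≡ e′ j → i ≡ j
        inj′ zero    zero    _  = refl
        inj′ zero    (suc j) eq = contradiction (subst P (sym eq) (ok j)) ¬p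
        inj′ (suc i) zero    eq = contradiction (subst P eq (ok i)) ¬p
        inj′ (suc i) (suc j) eq = cong suc (inj i j eq)
        ok′ : ∀ i → P (e′ i) ⊎ e′ i ≡ a
        ok′ zero    = inj₂ refl
        ok′ (suc i) = inj₁ (ok i)
        cov′ : ∀ x → P x ⊎ x ≡ a → Σ[ i ∈ Fin (suc k) ] e′ i ≡ x
        cov′ x (inj₁ p)  = let i , eq = cov x p in suc i , eq
        cov′ x (inj₂ eq) = zero , sym eq

  abstract
    exactly-unique : ∀ {A : Set} {P : A → Set} {k n} → ExactlyOf P k → ExactlyOf P n → k ≡ n
    exactly-unique x y = ≤-antisym (exactly-≤ (λ _ → id) x y) (exactly-≤ (λ _ → id) y x)

    -- An element of `Q` outside `P` could be inserted into `P`, giving `suc k` elements inside a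
    -- set of `k`.
    exactly-full : ∀ {A : Set} {P Q : A → Set} {k} → DecidableEquality A → (∀ a → P a → Q a) →
      ExactlyOf P k → ExactlyOf Q k → ∀ a → Q a → P a
    exactly-full _≟_ sub p q a qa with exactly-dec _≟_ p a
    ... | yes pa = pa
    ... | no ¬pa = contradiction
      (exactly-≤ (λ x → λ { (inj₁ px) → sub x px ; (inj₂ refl) → qa }) (exactly-insert ¬pa p) q) 1+n≰n

    exactly-delete : ∀ {A : Set} {P : A → Set} {k a} → P a →
      ExactlyOf P (suc k) → ExactlyOf (λ x → P x × x ≢ a) k
    exactly-delete {A} {P} {k} {a} pa (e , inj , ok , cov) with cov a pa
    ... | z , refl = e ∘ punchIn z
      , (λ i j eq → punchIn-injective z i j (inj _ _ eq))
      , (λ i → ok _ , λ eq → punchInᵢ≢i z i (inj _ _ eq))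
      , cov′
      where
      cov′ : ∀ x → P x × x ≢ e z → Σ[ i ∈ Fin k ] e (punchIn z i) ≡ x
      cov′ x (px , x≢) with cov x px
      ... | j , refl = punchOut z≢j , cong e (punchIn-punchOut z≢j)
        where
        z≢j : z ≢ j
        z≢j eq = x≢ (cong e (sym eq))

    exactly-2≤ : ∀ {A : Set} {P : A → Set} {k x y} → x ≢ y → P x → P y → ExactlyOf P k → 2 ≤ k
    exactly-2≤ {A} {P} {k} {x} {y} x≢y px py = exactly-≤ sub pair
      where
      pair : ExactlyOf (λ a → (⊥ ⊎ a ≡ x) ⊎ a ≡ y) 2
      pair = exactly-insert (λ { (inj₁ ()) ; (inj₂ eq) → x≢y (sym eq) })
        (exactly-insert id ((λ ()) , (λ ()) , (λ ()) , (λ _ ())))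
      sub : ∀ a → (⊥ ⊎ a ≡ x) ⊎ a ≡ y → P a
      sub a (inj₁ (inj₂ refl)) = px
      sub a (inj₂ refl)        = py

    -- The sets `R b`, for `b` in `Q`, partition `P` into parts of size `c`. Double counting below
    -- compares two counts of one set by `exactly-unique`.
    exactly-fibres : ∀ {A B : Set} {P : A → Set} {Q : B → Set} {R : B → A → Set} {n c} →
      ExactlyOf Q n → (∀ b → Q b → ExactlyOf (R b) c) →
      (∀ a → P a → Σ[ b ∈ B ] Q b × R b a) → (∀ b a → Q b → R b a → P a) →
      (∀ b b′ a → R b a → R b′ a → b ≡ b′) → ExactlyOf P (n * c)
    exactly-fibres {A} {B} {P} {Q} {R} {n} {c} (e , e-inj , e-ok , e-cov) fibre to from fun =
      f , f-inj , (λ i → from _ _ (e-ok _) (f-ok i)) , f-cov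
      where
      at : ∀ i → ExactlyOf (R (e i)) c
      at i = fibre (e i) (e-ok i)
      pick : Fin n × Fin c → A
      pick (i , j) = proj₁ (at i) j
      f : Fin (n * c) → A
      f = pick ∘ remQuot c
      f-ok : ∀ i → R (e (proj₁ (remQuot {n} c i))) (f i)
      f-ok i = proj₁ (proj₂ (proj₂ (at (proj₁ (remQuot c i))))) _
      pick-inj : ∀ p q → pick p ≡ pick q → p ≡ q
      pick-inj (i , j) (i′ , j′) eq
        with e-inj i i′ (fun _ _ _ (subst (R (e i)) eq (proj₁ (proj₂ (proj₂ (at i))) j))
                                    (proj₁ (proj₂ (proj₂ (at i′))) j′))
      ... | refl = cong (i ,_) (proj₁ (proj₂ (at i)) j j′ eq)
      f-inj : ∀ i j → f i ≡ f j → i ≡ j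
      f-inj i j eq = trans (sym (combine-remQuot {n} c i))
        (trans (cong (λ (x , y) → combine x y) (pick-inj (remQuot c i) (remQuot c j) eq)) (combine-remQuot {n} c j))
      f-cov : ∀ a → P a → Σ[ i ∈ Fin (n * c) ] f i ≡ a
      f-cov a pa with to a pa
      ... | b , qb , r with e-cov b qb
      ... | i , refl with proj₂ (proj₂ (proj₂ (at i))) a r
      ... | j , eq = combine i j , trans (cong pick (remQuot-combine i j)) eq

    -- The bijection is given as a relation so that incidence itself can match the points of a line
    -- with the lines of a pencil or parallel class.
    exactly-correspond : ∀ {A B : Set} {P : A → Set} {Q : B → Set} {n} (R : A → B → Set) →
      (∀ a → P a → Σ[ b ∈ B ] Q b × R a b) → (∀ b → Q b → Σ[ a ∈ A ] P a × R a b) →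
      (∀ a b b′ → P a → Q b → Q b′ → R a b → R a b′ → b ≡ b′) →
      (∀ a a′ b → P a → P a′ → Q b → R a b → R a′ b → a ≡ a′) →
      ExactlyOf P n → ExactlyOf Q n
    exactly-correspond {A} {B} {P} {Q} {n} R to from fun inj (e , e-inj , e-ok , e-cov) =
      f , f-inj , (λ i → proj₁ (proj₂ (im i))) , f-cov
      where
      im : ∀ i → Σ[ b ∈ B ] Q b × R (e i) b
      im i = to (e i) (e-ok i)
      f : Fin n → B
      f = proj₁ ∘ im
      f-inj : ∀ i j → f i ≡ f j → i ≡ j
      f-inj i j eq = e-inj i j (inj _ _ (f j) (e-ok i) (e-ok j) (proj₁ (proj₂ (im j)))
        (subst (R (e i)) eq (proj₂ (proj₂ (im i)))) (proj₂ (proj₂ (im j))))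
      f-cov : ∀ b → Q b → Σ[ i ∈ Fin n ] f i ≡ b
      f-cov b qb with from b qb
      ... | a , pa , r with e-cov a pa
      ... | i , refl = i , fun (e i) _ _ pa (proj₁ (proj₂ (im i))) qb (proj₂ (proj₂ (im i))) r

    exactly-× : ∀ {A B : Set} {P : A → Set} {Q : B → Set} {n c} → ExactlyOf P n → ExactlyOf Q c →
      ExactlyOf (λ (p : A × B) → P (proj₁ p) × Q (proj₂ p)) (n * c)
    exactly-× {A} {B} {P} {Q} p q = exactly-fibres {R = λ a x → proj₁ x ≡ a × Q (proj₂ x)} p
      (λ a _ → exactly-correspond (λ b x → proj₁ x ≡ a × proj₂ x ≡ b)
        (λ b qb → (a , b) , (refl , qb) , refl , refl)
        (λ { (_ , b) (refl , qb) → b , qb , refl , refl })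
        (λ { _ _ _ _ _ _ (refl , refl) (refl , refl) → refl })
        (λ { _ _ _ _ _ _ (_ , refl) (_ , refl) → refl }) q)
      (λ (a , b) (pa , qb) → a , pa , refl , qb)
      (λ { _ _ pa (refl , qb) → pa , qb })
      (λ { _ _ _ (refl , _) (eq , _) → eq })

    -- Stated for an abstract relation so as to cover a projective plane and its dual at once.
    plane-size : ∀ {A B : Set} {R : A → B → Set} {m} → DecidableEquality A → (a : A) →
      ExactlyOf (R a) (suc m) → (∀ b → ExactlyOf (λ x → R x b) (suc m)) →
      (∀ x → x ≢ a → Σ[ b ∈ B ] R a b × R x b) →
      (∀ x b c → x ≢ a → R a b → R a c → R x b → R x c → b ≡ c) → Counted A (NP m)
    plane-size {A} {B} {R} {m} _≟_ a lines points join unique =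
      subst (Counted A) (trans (cong suc (+-comm m (m * m))) (+-comm 1 (m * m + m)))
        (exactly-⇔ (λ _ _ → tt) (λ x _ → split x) (exactly-insert (λ ne → ne refl) others))
      where
      split : ∀ x → x ≢ a ⊎ x ≡ a
      split x with x ≟ a
      ... | yes eq = inj₂ eq
      ... | no ne  = inj₁ ne
      others : ExactlyOf (_≢ a) (suc m * m)
      -- Each of the `suc m` lines through `a` carries `m` further points, and every point other
      -- than `a` is on exactly one of these lines.
      others = exactly-fibres {R = λ b x → R a b × R x b × x ≢ a} lines
        (λ b ab → exactly-⇔ (λ x r → ab , r) (λ x r → proj₂ r) (exactly-delete ab (points b)))
        (λ x ne → let b , ab , xb = join x ne in b , ab , ab , xb , ne)
        (λ _ _ _ r → proj₂ (proj₂ r))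
        (λ b c x (ab , xb , ne) (ac , xc , _) → unique x b c ne ab ac xb xc)

open Counting

-- Parameters of a finite affine plane.

record AffineCounts {v b : ℕ} (A : Fin v → Fin b → Set) (n : ℕ) : Set where
  field
    2≤n     : 2 ≤ n
    points  : v ≡ n * n
    lines   : b ≡ n * n + n
    onLine  : ∀ L → ExactlyOf (λ x → A x L) n
    inClass : ∀ L → ExactlyOf (Parallel (mkInc (Fin v) (Fin b) A) L) n

module FiniteAffine {v b : ℕ} (A : Fin v → Fin b → Set) (A? : ∀ x L → Dec (A x L))
  (simple : Simple (mkInc (Fin v) (Fin b) A)) (affine : IsAffinePlane (mkInc (Fin v) (Fin b) A))
  (link : ∀ x y → Σ[ L ∈ Fin b ] A x L × A y L) where

  open IsAffinePlane affine

  _∥_ : Fin b → Fin b → Set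
  _∥_ = Parallel (mkInc (Fin v) (Fin b) A)

  abstract
    _∥?_ : ∀ L M → Dec (L ∥ M)
    L ∥? M = all? (λ x → (A? x L →-dec A? x M) ×-dec (A? x M →-dec A? x L))
      ⊎-dec all? (λ x → ¬? (A? x L ×-dec A? x M))

    ∥-refl : ∀ L → L ∥ L
    ∥-refl L = inj₁ λ x → id , id

    ∥-sym : ∀ L M → L ∥ M → M ∥ L
    ∥-sym L M (inj₁ same) = inj₁ λ x → proj₂ (same x) , proj₁ (same x)
    ∥-sym L M (inj₂ disj) = inj₂ λ x (p , q) → disj x (q , p)

    parallel-unique : ∀ {x L M K} → A x M → A x K → L ∥ M → L ∥ K → M ≡ K
    parallel-unique {x} {L} {M} {K} xM xK LM LK with playfair x L
    ... | N , _ , _ , uni = trans (sym (simple N M (uni M xM LM))) (simple N K (uni K xK LK))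

    join-unique : ∀ {x y L M} → x ≢ y → A x L → A y L → A x M → A y M → L ≡ M
    join-unique {x} {y} {L} {M} x≢y xL yL xM yM with join x y x≢y
    ... | N , _ , _ , uni = trans (sym (simple N L (uni L xL yL))) (simple N M (uni M xM yM))

    common : ∀ {L M} → ¬ L ∥ M → Σ[ x ∈ Fin v ] A x L × A x M
    common {L} {M} ¬LM = decidable-stable (any? (λ x → A? x L ×-dec A? x M))
      λ none → ¬LM (inj₂ λ x p → none (x , p))

    -- If `L` and `K` share a point, both are the parallel to `M` through it and hence equal.
    ∥-trans : ∀ {L M K} → L ∥ M → M ∥ K → L ∥ K
    ∥-trans {L} {M} {K} LM MK with any? (λ x → A? x L ×-dec A? x K)
    ... | no none = inj₂ λ x p → none (x , p)
    ... | yes (x , xL , xK) = subst (L ∥_) (parallel-unique xL xK (∥-sym L M LM) MK) (∥-refl L)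

    -- A line meets each member of a parallel class not containing it exactly once.
    class≈line : ∀ {L M n} → ¬ L ∥ M → ExactlyOf (λ x → A x M) n → ExactlyOf (L ∥_) n
    class≈line {L} {M} ¬LM = exactly-correspond A
      (λ x _ → let K , xK , LK , _ = playfair x L in K , LK , xK)
      (λ K LK → let x , xK , xM = common (λ KM → ¬LM (∥-trans LK KM)) in x , xM , xK)
      (λ x K N _ LK LN xK xN → parallel-unique xK xN LK LN)
      one
      where
      one : ∀ x y K → A x M → A y M → L ∥ K → A x K → A y K → x ≡ y
      one x y K xM yM LK xK yK with x ≟F y
      ... | yes eq = eq
      ... | no x≢y = contradiction (subst (L ∥_) (join-unique x≢y xK yK xM yM) LK) ¬LM

    size : ∀ L → Σ[ n ∈ ℕ ] ExactlyOf (λ x → A x L) n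
    size L = count (counted-Fin v) (λ x → A? x L)

    class : ∀ L → Σ[ n ∈ ℕ ] ExactlyOf (L ∥_) n
    class L = count (counted-Fin b) (L ∥?_)

    class-size : ∀ {L M} → ¬ L ∥ M → proj₁ (class L) ≡ proj₁ (size M)
    class-size {L} {M} ¬LM = exactly-unique (proj₂ (class L)) (class≈line ¬LM (proj₂ (size M)))

    meeting : ∀ {x y z L M} → A x L → A x M → A y L → A z M →
      ¬ Collinear (mkInc (Fin v) (Fin b) A) x y z → ¬ L ∥ M
    meeting xL xM yL zM ¬xyz (inj₁ same) = ¬xyz (_ , xL , yL , proj₂ (same _) zM)
    meeting xL xM yL zM ¬xyz (inj₂ disj) = disj _ (xL , xM)

    -- The points of `M` correspond to the lines through `x` that meet `M`; the parallel to `M`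
    -- through `x` is the one remaining line.
    pencil : ∀ {x M n} → ¬ A x M → ExactlyOf (λ y → A y M) n → ExactlyOf (A x) (suc n)
    pencil {x} {M} {n} x∉M onM with playfair x M
    ... | K , xK , MK , uni = exactly-⇔
      (λ L → λ { (inj₁ (xL , _)) → xL ; (inj₂ refl) → xK })
      split
      (exactly-insert {P = λ L → A x L × ¬ M ∥ L} (λ (_ , ¬MK) → ¬MK MK) crossing)
      where
      split : ∀ L → A x L → (A x L × ¬ M ∥ L) ⊎ L ≡ K
      split L xL with M ∥? L
      ... | yes ML = inj₂ (parallel-unique xL xK ML MK)
      ... | no ¬ML = inj₁ (xL , ¬ML)
      off : ∀ {y} → A y M → x ≢ y
      off yM refl = x∉M yM
      crosses : ∀ {y L} → A y M → A x L → A y L → ¬ M ∥ L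
      crosses yM xL yL (inj₁ same) = x∉M (proj₂ (same x) xL)
      crosses yM xL yL (inj₂ disj) = disj _ (yM , yL)
      one : ∀ y z L → A y M → A z M → A x L × ¬ M ∥ L → A y L → A z L → y ≡ z
      one y z L yM zM (xL , ¬ML) yL zL with y ≟F z
      ... | yes eq = eq
      ... | no y≢z = contradiction (subst (M ∥_) (join-unique y≢z yM zM yL zL) (∥-refl M)) ¬ML
      crossing : ExactlyOf (λ L → A x L × ¬ M ∥ L) n
      crossing = exactly-correspond A
        (λ y yM → let L , xL , yL , _ = join x y (off yM) in L , (xL , crosses yM xL yL) , yL)
        (λ L (xL , ¬ML) → let y , yM , yL = common ¬ML in y , yM , yL)
        (λ y L N yM (xL , _) (xN , _) yL yN → join-unique (off yM) xL yL xN yN)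
        one onM

    -- The sides of a triangle are pairwise nonparallel, and a class has as many lines as a line
    -- outside it has points; so all lines and classes have one size `n`. The class of `K`
    -- partitions the points, and the classes of the `suc n` lines through `z` partition the lines.
    counts : Σ[ n ∈ ℕ ] AffineCounts A n
    counts with nondeg
    -- `nondeg` does not state that the three points are distinct, so the sides come from `link`,
    -- which also joins a point to itself.
    ... | x , y , z , ¬xyz with link x y | link y z | link x z
    ... | K , xK , yK | L , yL , zL | M , xM , zM = n , record
      { 2≤n     = let _ , _ , ne , p , q = lineHasTwoPts K in exactly-2≤ ne p q (proj₂ (size K))
      ; points  = exactly-unique (counted-Fin v) (exactly-fibres {R = λ N w → A w N × K ∥ N}
          (inClassₙ K) (λ N KN → exactly-⇔ (λ _ p → p , KN) (λ _ → proj₁) (onLineₙ N))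
          (λ w _ → let N , wN , KN , _ = playfair w K in N , KN , wN , KN)
          (λ _ _ _ _ → tt)
          (λ N N′ w (wN , KN) (wN′ , KN′) → parallel-unique wN wN′ KN KN′))
      ; lines   = trans (exactly-unique (counted-Fin b) (exactly-fibres {R = λ N N′ → A z N × N ∥ N′}
          (pencil z∉K (onLineₙ K)) (λ N zN → exactly-⇔ (λ _ p → zN , p) (λ _ → proj₂) (inClassₙ N))
          (λ N′ _ → let N , zN , N′N , _ = playfair z N′ in N , zN , zN , ∥-sym N′ N N′N)
          (λ _ _ _ _ → tt)
          (λ N N′ w (zN , Nw) (zN′ , N′w) → parallel-unique zN zN′ (∥-sym N w Nw) (∥-sym N′ w N′w))))
          (+-comm n (n * n))
      ; onLine  = onLineₙ
      ; inClass = inClassₙ }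
      where
      n : ℕ
      n = proj₁ (size K)
      z∉K : ¬ A z K
      z∉K zK = ¬xyz (K , xK , yK , zK)
      KL : ¬ K ∥ L
      KL = meeting yK yL xK zL (λ (N , a , b , c) → ¬xyz (N , b , a , c))
      KM : ¬ K ∥ M
      KM = meeting xK xM yK zM ¬xyz
      LM : ¬ L ∥ M
      LM = meeting zL zM yL xM (λ (N , a , b , c) → ¬xyz (N , c , b , a))
      flip : ∀ {N N′} → ¬ N ∥ N′ → ¬ N′ ∥ N
      flip ne p = ne (∥-sym _ _ p)
      sizeL : proj₁ (size L) ≡ n
      sizeL = trans (sym (class-size (flip LM))) (class-size (flip KM))
      class≡n : ∀ N → proj₁ (class N) ≡ n
      class≡n N with N ∥? K
      ... | no ¬NK = class-size ¬NK
      ... | yes NK = trans (class-size {M = L} λ NL → KL (∥-trans (∥-sym N K NK) NL)) sizeL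
      size≡n : ∀ N → proj₁ (size N) ≡ n
      size≡n N with K ∥? N
      ... | no ¬KN = trans (sym (class-size ¬KN)) (class≡n K)
      ... | yes KN = trans (sym (class-size {L = L} λ LN → KL (∥-trans KN (∥-sym L N LN)))) (class≡n L)
      onLineₙ : ∀ N → ExactlyOf (λ w → A w N) n
      onLineₙ N = subst (ExactlyOf _) (size≡n N) (proj₂ (size N))
      inClassₙ : ∀ N → ExactlyOf (N ∥_) n
      inClassₙ N = subst (ExactlyOf _) (class≡n N) (proj₂ (class N))

-- Lines have to be reached only up to their point sets, because a line of a neighbourhood has many
-- representatives in `Nbhd`.
affine-transport : (S : IncStr) {PT LT : Set} (pt : PT → IncStr.Point S) (ln : LT → IncStr.Line S) →
  (∀ i j → pt i ≡ pt j → i ≡ j) → (∀ x → Σ[ i ∈ PT ] pt i ≡ x) →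
  (∀ L → Σ[ j ∈ LT ] SamePts S (ln j) L) →
  IsAffinePlane S → IsAffinePlane (mkInc PT LT (λ i j → IncStr._I_ S (pt i) (ln j)))
affine-transport S {PT} {LT} pt ln pt-inj pt-surj ln-surj affine = record
  { lineHasTwoPts = two
  ; join          = joinT
  ; playfair      = playfairT
  ; nondeg        = nondegT }
  where
  open IncStr S
  open IsAffinePlane affine
  T : IncStr
  T = mkInc PT LT (λ i j → pt i I ln j)
  two : ∀ L → Σ[ i ∈ PT ] Σ[ j ∈ PT ] (i ≢ j × pt i I ln L × pt j I ln L)
  two L with lineHasTwoPts (ln L)
  ... | x , y , x≢y , xL , yL with pt-surj x | pt-surj y
  ... | i , refl | j , refl = i , j , (λ eq → x≢y (cong pt eq)) , xL , yL
  joinT : ∀ i j → i ≢ j → Σ[ L ∈ LT ] (pt i I ln L × pt j I ln L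
    × (∀ M → pt i I ln M → pt j I ln M → SamePts T L M))
  joinT i j i≢j with join (pt i) (pt j) (λ eq → i≢j (pt-inj i j eq))
  ... | L , iL , jL , uni with ln-surj L
  ... | L′ , same = L′ , proj₂ (same _) iL , proj₂ (same _) jL , λ M iM jM k →
    (λ p → proj₁ (uni (ln M) iM jM (pt k)) (proj₁ (same _) p))
    , (λ p → proj₂ (same _) (proj₂ (uni (ln M) iM jM (pt k)) p))
  toS : ∀ L M → Parallel T L M → Parallel S (ln L) (ln M)
  toS L M (inj₁ same) = inj₁ go
    where
    go : SamePts S (ln L) (ln M)
    go x with pt-surj x
    ... | i , refl = same i
  toS L M (inj₂ disj) = inj₂ go
    where
    go : ∀ x → ¬ (x I ln L × x I ln M)
    go x with pt-surj x
    ... | i , refl = disj i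
  playfairT : ∀ i L → Σ[ L′ ∈ LT ] (pt i I ln L′ × Parallel T L L′
    × (∀ M → pt i I ln M → Parallel T L M → SamePts T L′ M))
  playfairT i L with playfair (pt i) (ln L)
  ... | K , iK , LK , uni with ln-surj K
  ... | L′ , same = L′ , proj₂ (same _) iK , par LK , λ M iM LM k →
    (λ p → proj₁ (uni (ln M) iM (toS L M LM) (pt k)) (proj₁ (same _) p))
    , (λ p → proj₂ (same _) (proj₂ (uni (ln M) iM (toS L M LM) (pt k)) p))
    where
    par : Parallel S (ln L) K → Parallel T L L′
    par (inj₁ s) = inj₁ λ k → (λ p → proj₂ (same _) (proj₁ (s _) p)) , (λ p → proj₂ (s _) (proj₁ (same _) p))
    par (inj₂ d) = inj₂ λ k (p , q) → d (pt k) (p , proj₁ (same _) q)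
  nondegT : Σ[ i ∈ PT ] Σ[ j ∈ PT ] Σ[ k ∈ PT ] ¬ Collinear T i j k
  nondegT with nondeg
  ... | x , y , z , ¬xyz with pt-surj x | pt-surj y | pt-surj z
  ... | i , refl | j , refl | k , refl = i , j , k , λ (L , p) → ¬xyz (ln L , p)

bijection : ∀ {A B : Set} (f : B → A) → (∀ p q → f p ≡ f q → p ≡ q) → (∀ a → Σ[ b ∈ B ] f b ≡ a) → A ↔ B
bijection f inj surj = mk↔ₛ′ (proj₁ ∘ surj) f (λ b → inj _ _ (proj₂ (surj (f b)))) (proj₂ ∘ surj)

-- Decidability of incidence and of the neighbour relation.

module Hjelmslev (H Π : IncStr) (φ : Epi H Π) (finite : Finite H) (php : IsPHP H Π φ)
  (uniform : TwoUniform H Π φ) where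

  open IncStr H renaming (_I_ to _∈_)
  open IncStr Π using () renaming (Point to Pointᴾ; Line to Lineᴾ; _I_ to _∈ᴾ_)
  open Epi φ
  open IsPHP php

  finPoint : Counted Point (proj₁ finite)
  finPoint = proj₁ (proj₂ finite)

  finLine : Counted Line (proj₁ (proj₂ (proj₂ finite)))
  finLine = proj₂ (proj₂ (proj₂ finite))

  near-≡ : ∀ {X x y} {p : fp x ≡ X} {q : fp y ≡ X} → x ≡ y → (x , p) ≡ (y , q)
  near-≡ {p = refl} {q = refl} refl = refl

  multiplicity : Point → ℕ
  multiplicity x = proj₁ (proj₂ (uniform x))

  abstract
    -- x lies on g iff g restricts near x like one of the chosen joins of x with another point,
    -- and coincidence of restrictions is decidable because the lines with a given restriction
    -- are enumerated.
    _∈?_ : ∀ x g → Dec (x ∈ g)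
    x ∈? g = map′ sound complete
      (counted-any? finPoint λ y → exactly-dec (counted-≟ finLine) (proj₂ (proj₂ (uniform x)) (through y)) g)
      where
      through : Point → IncStr.Line (Nbhd H Π φ x)
      through y = proj₁ (ax1 x y) , x , refl , proj₁ (proj₂ (ax1 x y))
      sound : Σ[ y ∈ Point ] RestrictsTo H Π φ x g (through y) → x ∈ g
      sound (y , r) = proj₂ (r (x , refl)) (proj₁ (proj₂ (ax1 x y)))
      -- In the affine plane around `x`, both `g` and the chosen join restrict to the unique line
      -- through `x` and `y`.
      via : x ∈ g → (y : IncStr.Point (Nbhd H Π φ x)) → proj₁ y ∈ g → (x , refl) ≢ y →
        RestrictsTo H Π φ x g (through (proj₁ y))
      via x∈g y y∈g x≢y q with IsAffinePlane.join (proj₁ (uniform x)) (x , refl) y x≢y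
      ... | L , _ , _ , uni =
        let s = uni (g , x , refl , x∈g) x∈g y∈g q
            t = uni (through (proj₁ y)) (proj₁ (proj₂ (ax1 x (proj₁ y)))) (proj₂ (proj₂ (ax1 x (proj₁ y)))) q
        in proj₁ t ∘ proj₂ s , proj₁ s ∘ proj₂ t
      complete : x ∈ g → Σ[ y ∈ Point ] RestrictsTo H Π φ x g (through y)
      complete x∈g with IsAffinePlane.lineHasTwoPts (proj₁ (uniform x)) (g , x , refl , x∈g)
      ... | y , z , y≢z , y∈g , z∈g with counted-≟ finPoint x (proj₁ y)
      ... | no x≢y = proj₁ y , via x∈g y y∈g (x≢y ∘ cong proj₁)
      ... | yes x≡y = proj₁ z , via x∈g z z∈g λ x≡z → y≢z (trans (near-≡ (sym x≡y)) x≡z)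

    -- Two joins force equal images by `ax4`. Conversely, the restriction of a join of two
    -- neighbours comes from at least two lines, and all of them contain both points.
    near-dec : (∀ x → 2 ≤ multiplicity x) → ∀ x y → Dec (fp x ≡ fp y)
    near-dec 2≤ x y with counted-≟ finPoint x y
    ... | yes refl = yes refl
    ... | no x≢y with counted-any? finLine (λ g → counted-any? finLine λ h →
                        ¬? (counted-≟ finLine g h) ×-dec ((x ∈? g) ×-dec (x ∈? h)) ×-dec ((y ∈? g) ×-dec (y ∈? h)))
    ... | yes (g , h , g≢h , (xg , xh) , yg , yh) = yes (ax4 x y g h g≢h xg xh yg yh)
    ... | no none = no λ x~y → none (two x~y)
      where
      two : fp x ≡ fp y → Σ[ g ∈ Line ] Σ[ h ∈ Line ] (g ≢ h × (x ∈ g × x ∈ h) × (y ∈ g × y ∈ h))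
      two x~y with ax1 x y
      ... | g , xg , yg with multiplicity x | 2≤ x | proj₂ (proj₂ (uniform x)) (g , x , refl , xg)
      ... | suc zero | s≤s () | _
      ... | suc (suc k) | _ | e , inj , ok , _ = e zero , e (suc zero)
        , (λ eq → contradiction (inj _ _ eq) λ ())
        , (proj₂ (ok zero (x , refl)) xg , proj₂ (ok (suc zero) (x , refl)) xg)
        , (proj₂ (ok zero (y , sym x~y)) yg , proj₂ (ok (suc zero) (y , sym x~y)) yg)

  -- Combinatorics of the image plane.

  module Discrete (_≟ᴾ_ : DecidableEquality Pointᴾ) where

    open IsProjectivePlane target

    abstract
      finPointᴾ : Σ[ k ∈ ℕ ] Counted Pointᴾ k
      finPointᴾ = counted-image finPoint _≟ᴾ_ fp fpSurj

      -- Obtained from `ax1` by lifting both points, so that it covers `X ≡ Y` as well; `meetᴾ` does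
      -- the same for lines.
      joinᴾ : ∀ X Y → Σ[ l ∈ Lineᴾ ] X ∈ᴾ l × Y ∈ᴾ l
      joinᴾ X Y with fpSurj X | fpSurj Y
      ... | x , refl | y , refl = let g , xg , yg = ax1 x y in fl g , pres x g xg , pres y g yg

      meetᴾ : ∀ l m → Σ[ X ∈ Pointᴾ ] X ∈ᴾ l × X ∈ᴾ m
      meetᴾ l m with flSurj l | flSurj m
      ... | g , refl | h , refl = let x , xg , xh = ax2 g h in fp x , pres x g xg , pres x h xh

      join-unique : ∀ {X Y l m} → X ≢ Y → X ∈ᴾ l → Y ∈ᴾ l → X ∈ᴾ m → Y ∈ᴾ m → l ≡ m
      join-unique X≢Y Xl Yl Xm Ym with join _ _ X≢Y
      ... | _ , _ , _ , uni = trans (uni _ Xl Yl) (sym (uni _ Xm Ym))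

      meet-unique : ∀ {X Y l m} → l ≢ m → X ∈ᴾ l → X ∈ᴾ m → Y ∈ᴾ l → Y ∈ᴾ m → X ≡ Y
      meet-unique l≢m Xl Xm Yl Ym with meet _ _ l≢m
      ... | _ , _ , _ , uni = trans (uni _ Xl Xm) (sym (uni _ Yl Ym))

    abstract
      -- Otherwise every line joining a point over X to some other point would have the image of g,
      -- and all of Π would lie on that image.
      lift : ∀ {X} g → X ∈ᴾ fl g → Σ[ x ∈ Point ] fp x ≡ X × x ∈ g
      lift {X} g Xg = decidable-stable (counted-any? finPoint λ x → (fp x ≟ᴾ X) ×-dec (x ∈? g)) absurd
        where
        module _ (none : ¬ (Σ[ x ∈ Point ] fp x ≡ X × x ∈ g)) where
          all-on : ∀ Y → ¬ ¬ (Y ∈ᴾ fl g)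
          all-on Y Y∉ with fpSurj X | fpSurj Y
          ... | x , refl | y , refl with ax1 x y
          ... | h , xh , yh with ax2 g h
          ... | z , zg , zh = none (z , meet-unique g≢h (pres z g zg) (pres z h zh) Xg (pres x h xh) , zg)
            where
            g≢h : fl g ≢ fl h
            g≢h eq = Y∉ (subst (fp y ∈ᴾ_) (sym eq) (pres y h yh))
          absurd : ⊥
          absurd with nondeg
          ... | A , B , C , _ , ¬ABC , _ =
            all-on A λ a → all-on B λ b → all-on C λ c → ¬ABC (fl g , a , b , c)

      -- By `lift`, `X` is on the image of `g` iff some point of `g` lies over `X`, which is a
      -- finite search.
      _∈ᴾ?_ : ∀ X l → Dec (X ∈ᴾ l)
      X ∈ᴾ? l with flSurj l
      ... | g , refl = map′ (λ { (x , refl , xg) → pres x g xg }) (lift g)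
        (counted-any? finPoint λ x → (fp x ≟ᴾ X) ×-dec (x ∈? g))

    Collinearᴾ : Pointᴾ → Pointᴾ → Pointᴾ → Set
    Collinearᴾ = Collinear Π

    Quadrangle : Pointᴾ → Pointᴾ → Pointᴾ → Pointᴾ → Set
    Quadrangle A B C D = ¬ Collinearᴾ A B C × ¬ Collinearᴾ A B D × ¬ Collinearᴾ A C D × ¬ Collinearᴾ B C D

    abstract
      rotate : ∀ {A B C D} → Quadrangle A B C D → Quadrangle B C D A
      rotate (abc , abd , acd , bcd) = bcd
        , (λ (l , b , c , a) → abc (l , a , b , c))
        , (λ (l , b , d , a) → abd (l , a , b , d))
        , (λ (l , c , d , a) → acd (l , a , c , d))

      noncollinear-≢ : ∀ {A B C} → ¬ Collinearᴾ A B C → A ≢ B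
      noncollinear-≢ {A} {C = C} ¬ABC refl = let l , a , c = joinᴾ A C in ¬ABC (l , a , a , c)

      -- If l had no points besides P and R, every line would pass through P or R.
      -- Then each triangle of a quadrangle has P or R as a vertex, so P and R are two of its four
      -- vertices, but the line through the other two vertices misses both.
      third-point : ∀ l P R → Σ[ X ∈ Pointᴾ ] X ∈ᴾ l × X ≢ P × X ≢ R
      third-point l P R = decidable-stable
        (counted-any? (proj₂ finPointᴾ) λ X → (X ∈ᴾ? l) ×-dec (¬? (X ≟ᴾ P) ×-dec ¬? (X ≟ᴾ R))) absurd
        where
        module _ (none : ¬ (Σ[ X ∈ Pointᴾ ] X ∈ᴾ l × X ≢ P × X ≢ R)) where
          V : Pointᴾ → Set
          V X = X ≡ P ⊎ X ≡ R
          hit : ∀ m → P ∈ᴾ m ⊎ R ∈ᴾ m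
          hit m with meetᴾ l m
          ... | X , Xl , Xm with X ≟ᴾ P | X ≟ᴾ R
          ... | yes refl | _        = inj₁ Xm
          ... | no _     | yes refl = inj₂ Xm
          ... | no X≢P   | no X≢R   = contradiction (X , Xl , X≢P , X≢R) none
          triangle : ∀ A B C → ¬ Collinearᴾ A B C → V A ⊎ V B ⊎ V C
          triangle A B C ¬ABC with joinᴾ A B | joinᴾ B C | joinᴾ A C
          ... | c , Ac , Bc | a , Ba , Ca | b , Ab , Cb = go (hit c) (hit a) (hit b)
            where
            c≢a : c ≢ a
            c≢a refl = ¬ABC (c , Ac , Bc , Ca)
            c≢b : c ≢ b
            c≢b refl = ¬ABC (c , Ac , Bc , Cb)
            a≢b : a ≢ b
            a≢b refl = ¬ABC (a , Ab , Ba , Ca)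
            atA : ∀ {X} → X ∈ᴾ c → X ∈ᴾ b → A ≡ X
            atA Xc Xb = meet-unique c≢b Ac Ab Xc Xb
            atB : ∀ {X} → X ∈ᴾ c → X ∈ᴾ a → B ≡ X
            atB Xc Xa = meet-unique c≢a Bc Ba Xc Xa
            atC : ∀ {X} → X ∈ᴾ a → X ∈ᴾ b → C ≡ X
            atC Xa Xb = meet-unique a≢b Ca Cb Xa Xb
            -- Each of the three sides contains `P` or `R`, so two sides contain the same one, which
            -- is then the vertex where they meet.
            go : P ∈ᴾ c ⊎ R ∈ᴾ c → P ∈ᴾ a ⊎ R ∈ᴾ a → P ∈ᴾ b ⊎ R ∈ᴾ b → V A ⊎ V B ⊎ V C
            go (inj₁ Pc) (inj₁ Pa) _         = inj₂ (inj₁ (inj₁ (atB Pc Pa)))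
            go (inj₂ Rc) (inj₂ Ra) _         = inj₂ (inj₁ (inj₂ (atB Rc Ra)))
            go (inj₁ Pc) (inj₂ Ra) (inj₁ Pb) = inj₁ (inj₁ (atA Pc Pb))
            go (inj₁ Pc) (inj₂ Ra) (inj₂ Rb) = inj₂ (inj₂ (inj₂ (atC Ra Rb)))
            go (inj₂ Rc) (inj₁ Pa) (inj₁ Pb) = inj₂ (inj₂ (inj₁ (atC Pa Pb)))
            go (inj₂ Rc) (inj₁ Pa) (inj₂ Rb) = inj₁ (inj₂ (atA Rc Rb))
          two-vertices : ∀ {X Y Z W} → V X → V Y → X ≢ Y → ¬ Collinearᴾ X Z W → ¬ Collinearᴾ Y Z W → ⊥
          two-vertices {X} {Y} {Z} {W} VX VY X≢Y ¬XZW ¬YZW with joinᴾ Z W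
          ... | m , Zm , Wm = go VX VY (hit m)
            where
            X∉ : ¬ X ∈ᴾ m
            X∉ Xm = ¬XZW (m , Xm , Zm , Wm)
            Y∉ : ¬ Y ∈ᴾ m
            Y∉ Ym = ¬YZW (m , Ym , Zm , Wm)
            go : V X → V Y → P ∈ᴾ m ⊎ R ∈ᴾ m → ⊥
            go (inj₁ refl) (inj₁ refl) _         = X≢Y refl
            go (inj₂ refl) (inj₂ refl) _         = X≢Y refl
            go (inj₁ refl) (inj₂ refl) (inj₁ Pm) = X∉ Pm
            go (inj₁ refl) (inj₂ refl) (inj₂ Rm) = Y∉ Rm
            go (inj₂ refl) (inj₁ refl) (inj₁ Pm) = Y∉ Pm
            go (inj₂ refl) (inj₁ refl) (inj₂ Rm) = X∉ Rm
          no-vertex : ∀ {A B C D} → Quadrangle A B C D → ¬ V A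
          no-vertex {A} {B} {C} {D} (abc , abd , acd , bcd) VA with triangle B C D bcd
          ... | inj₁ VB        = two-vertices VA VB (noncollinear-≢ abc) acd bcd
          ... | inj₂ (inj₁ VC) = two-vertices VA VC (noncollinear-≢ acd) abd
                                   (λ (l , c , b , d) → bcd (l , b , c , d))
          ... | inj₂ (inj₂ VD) = two-vertices VA VD
                                   (noncollinear-≢ (λ (l , a , d , b) → abd (l , a , b , d))) abc
                                   (λ (l , d , b , c) → bcd (l , b , c , d))
          absurd : ⊥
          absurd with nondeg
          ... | A , B , C , D , q with triangle A B C (proj₁ q)
          ... | inj₁ VA        = no-vertex q VA
          ... | inj₂ (inj₁ VB) = no-vertex (rotate q) VB
          ... | inj₂ (inj₂ VC) = no-vertex (rotate (rotate q)) VC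

      two-points : ∀ l → Σ[ X ∈ Pointᴾ ] Σ[ Y ∈ Pointᴾ ] X ≢ Y × X ∈ᴾ l × Y ∈ᴾ l
      two-points l with third-point l (proj₁ nondeg) (proj₁ nondeg)
      ... | X , Xl , _ with third-point l X X
      ... | Y , Yl , Y≢X , _ = X , Y , Y≢X ∘ sym , Xl , Yl

      _≟ᴸ_ : DecidableEquality Lineᴾ
      l ≟ᴸ m with two-points l
      ... | X , Y , X≢Y , Xl , Yl = map′ (λ (Xm , Ym) → join-unique X≢Y Xl Yl Xm Ym)
        (λ { refl → Xl , Yl }) ((X ∈ᴾ? m) ×-dec (Y ∈ᴾ? m))

      finLineᴾ : Σ[ k ∈ ℕ ] Counted Lineᴾ k
      finLineᴾ = counted-image finLine _≟ᴸ_ fl flSurj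

    -- Restrictions of lines to neighbourhoods.

    SameAt : Pointᴾ → Line → Line → Set
    SameAt X g h = ∀ x → fp x ≡ X → (x ∈ g → x ∈ h) × (x ∈ h → x ∈ g)

    abstract
      SameAt-refl : ∀ X g → SameAt X g g
      SameAt-refl X g x _ = id , id

      SameAt-sym : ∀ X g h → SameAt X g h → SameAt X h g
      SameAt-sym X g h s x p = proj₂ (s x p) , proj₁ (s x p)

      SameAt-trans : ∀ {X g h k} → SameAt X g h → SameAt X h k → SameAt X g k
      SameAt-trans s t x p = proj₁ (t x p) ∘ proj₁ (s x p) , proj₂ (s x p) ∘ proj₂ (t x p)

      SameAt? : ∀ X g h → Dec (SameAt X g h)
      SameAt? X g h = counted-all? finPoint λ x → (fp x ≟ᴾ X) →-dec
        (((x ∈? g) →-dec (x ∈? h)) ×-dec ((x ∈? h) →-dec (x ∈? g)))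

    ParallelAt : Pointᴾ → Line → Line → Set
    ParallelAt X g h = SameAt X g h ⊎ (∀ x → fp x ≡ X → ¬ (x ∈ g × x ∈ h))

    two-near : ∀ {X} g → X ∈ᴾ fl g →
      Σ[ x ∈ Point ] Σ[ y ∈ Point ] x ≢ y × (fp x ≡ X × x ∈ g) × (fp y ≡ X × y ∈ g)
    two-near g Xg with lift g Xg
    ... | z , refl , zg with IsAffinePlane.lineHasTwoPts (proj₁ (uniform z)) (g , z , refl , zg)
    ... | (x , x~) , (y , y~) , ne , xg , yg = x , y , ne ∘ near-≡ , (x~ , xg) , (y~ , yg)

    -- A restriction contains two distinct points, so lines sharing it have the same image by `ax3`.
    SameAt⇒fl≡ : ∀ {X g h} → X ∈ᴾ fl g → SameAt X g h → fl g ≡ fl h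
    SameAt⇒fl≡ {X} {g} {h} Xg s with two-near g Xg
    ... | x , y , x≢y , (x~ , xg) , (y~ , yg) =
      ax3 g h x y x≢y xg yg (proj₁ (s x x~) xg) (proj₁ (s y y~) yg)

    -- If the images differed, they would meet only in `X`; the common point of `g` and `h` would
    -- then lie over `X`, contradicting disjointness there.
    ParallelAt⇒fl≡ : ∀ {X g h} → X ∈ᴾ fl g → X ∈ᴾ fl h → ParallelAt X g h → fl g ≡ fl h
    ParallelAt⇒fl≡ Xg Xh (inj₁ s) = SameAt⇒fl≡ Xg s
    ParallelAt⇒fl≡ {X} {g} {h} Xg Xh (inj₂ d) with fl g ≟ᴸ fl h
    ... | yes eq = eq
    ... | no ne with ax2 g h
    ... | z , zg , zh = contradiction (zg , zh) (d z (meet-unique ne (pres z g zg) (pres z h zh) Xg Xh))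

    -- The neighbourhood over `X`, indexed by `Fin`: lines are represented by one line of `H` per
    -- restriction. The condition `X ∈ᴾ fl g` expresses that the restriction of `g` is nonempty, by
    -- `pres` and `lift`.
    record Frame (X : Pointᴾ) (v b : ℕ) : Set where
      field
        pt      : Fin v → Point
        pt-enum : IsEnumOf (λ x → fp x ≡ X) pt
        ln      : Fin b → Line
        ln-enum : Transversal (λ g → X ∈ᴾ fl g) (SameAt X) ln

      plane : IncStr
      plane = mkInc (Fin v) (Fin b) (λ i j → pt i ∈ ln j)

      near : ∀ i → fp (pt i) ≡ X
      near = proj₁ (proj₂ pt-enum)

      through : ∀ j → X ∈ᴾ fl (ln j)
      through = proj₁ (proj₂ ln-enum)

      pt-index : ∀ x → fp x ≡ X → Σ[ i ∈ Fin v ] pt i ≡ x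
      pt-index = proj₂ (proj₂ pt-enum)

      ln-index : ∀ g → X ∈ᴾ fl g → Σ[ j ∈ Fin b ] SameAt X (ln j) g
      ln-index = proj₂ (proj₂ ln-enum)

      SamePts⇒SameAt : ∀ j k → SamePts plane j k → SameAt X (ln j) (ln k)
      SamePts⇒SameAt j k s x p with pt-index x p
      ... | i , refl = s i

      simple : Simple plane
      simple j k s = proj₁ ln-enum j k (SamePts⇒SameAt j k s)

      parallel⇒ : ∀ j k → Parallel plane j k → ParallelAt X (ln j) (ln k)
      parallel⇒ j k (inj₁ s) = inj₁ (SamePts⇒SameAt j k s)
      parallel⇒ j k (inj₂ d) = inj₂ disj
        where
        disj : ∀ x → fp x ≡ X → ¬ (x ∈ ln j × x ∈ ln k)
        disj x p with pt-index x p
        ... | i , refl = d i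

      parallel⇐ : ∀ j k → ParallelAt X (ln j) (ln k) → Parallel plane j k
      parallel⇐ j k (inj₁ s) = inj₁ λ i → s (pt i) (near i)
      parallel⇐ j k (inj₂ d) = inj₂ λ i → d (pt i) (near i)

      link : ∀ i i′ → Σ[ j ∈ Fin b ] pt i ∈ ln j × pt i′ ∈ ln j
      link i i′ with ax1 (pt i) (pt i′)
      ... | g , p , q with ln-index g (subst (_∈ᴾ fl g) (near i) (pres _ g p))
      ... | j , s = j , proj₂ (s _ (near i)) p , proj₂ (s _ (near i′)) q

    abstract
      frame : ∀ X → Σ[ v ∈ ℕ ] Σ[ b ∈ ℕ ] Frame X v b
      frame X with count finPoint (λ x → fp x ≟ᴾ X)
                 | transversal finLine (λ g → X ∈ᴾ? fl g) (SameAt? X) (SameAt-refl X) (SameAt-sym X)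
      ... | v , pt , pt-enum | b , ln , ln-enum =
        v , b , record { pt = pt ; pt-enum = pt-enum ; ln = ln ; ln-enum = ln-enum }

      frame-affine : ∀ {X v b} (F : Frame X v b) → IsAffinePlane (Frame.plane F)
      frame-affine {X} {v} {b} F with fpSurj X
      ... | x , refl = affine-transport (Nbhd H Π φ x)
        (λ i → pt i , near i)
        (λ j → ln j , lift (ln j) (through j))
        (λ i j eq → proj₁ pt-enum i j (cong proj₁ eq))
        (λ (y , p) → let i , eq = pt-index y p in i , near-≡ eq)
        (λ (g , y , p , yg) →
          let j , s = ln-index g (subst (_∈ᴾ fl g) p (pres y g yg)) in j , λ (z , q) → s z q)
        (proj₁ (uniform x))
        where open Frame F

    record Regular (X : Pointᴾ) (n : ℕ) : Set where
      field
        frameₙ  : Frame X (n * n) (n * n + n)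
        2≤n     : 2 ≤ n
        onLine  : ∀ j → ExactlyOf (λ i → Frame.pt frameₙ i ∈ Frame.ln frameₙ j) n
        inClass : ∀ j → ExactlyOf (Parallel (Frame.plane frameₙ) j) n
      open Frame frameₙ public

      instance
        n≢0 : NonZero n
        n≢0 = >-nonZero (≤-trans (s≤s z≤n) 2≤n)

      onLineH : ∀ g → X ∈ᴾ fl g → ExactlyOf (λ x → fp x ≡ X × x ∈ g) n
      onLineH g Xg with ln-index g Xg
      ... | j , s = exactly-correspond (λ i x → pt i ≡ x)
        (λ i p → pt i , (near i , proj₁ (s _ (near i)) p) , refl)
        (λ x (x~ , xg) → let i , eq = pt-index x x~ in
          i , subst (_∈ ln j) (sym eq) (proj₂ (s x x~) xg) , eq)
        (λ { _ _ _ _ _ _ refl refl → refl })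
        (λ i i′ x _ _ _ p q → proj₁ pt-enum i i′ (trans p (sym q)))
        (onLine j)

    abstract
      regular : ∀ X → Σ[ n ∈ ℕ ] Regular X n
      regular X with frame X
      ... | v , b , F = let n , c = FiniteAffine.counts (λ i j → pt i ∈ ln j) (λ i j → pt i ∈? ln j)
                                      simple (frame-affine F) link
                        in n , resize F (AffineCounts.points c) (AffineCounts.lines c) c
        where
        open Frame F
        -- With both sizes generalised, their equations match `refl` and the frame is retyped
        -- without transporting its fields.
        resize : ∀ {v b n} (F : Frame X v b) → v ≡ n * n → b ≡ n * n + n →
          AffineCounts (λ i j → Frame.pt F i ∈ Frame.ln F j) n → Regular X n
        resize F refl refl c = record
          { frameₙ = F ; 2≤n = AffineCounts.2≤n c
          ; onLine = AffineCounts.onLine c ; inClass = AffineCounts.inClass c }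

    -- Lines over a line of the image plane, and the common order.

    joinᴴ-unique : ∀ {g h x y} → fp x ≢ fp y → x ∈ g → x ∈ h → y ∈ g → y ∈ h → g ≡ h
    joinᴴ-unique {g} {h} {x} {y} x≁y xg xh yg yh with counted-≟ finLine g h
    ... | yes eq = eq
    ... | no g≢h = contradiction (ax4 x y g h g≢h xg xh yg yh) x≁y

    -- Points over distinct X, Y on l have exactly one join, so counting pairs of such points
    -- gives (mn)² = (number of lines over l) · mn.
    over-count : ∀ {l X Y m n} → X ≢ Y → X ∈ᴾ l → Y ∈ᴾ l → Regular X m → Regular Y n →
      ExactlyOf (λ g → fl g ≡ l) (m * n)
    over-count {l} {X} {Y} {m} {n} X≢Y Xl Yl RX RY with count finLine (λ g → fl g ≟ᴸ l)
    ... | N , over = subst (ExactlyOf _) (*-cancelʳ-≡ N (m * n) (m * n) (sym total)) over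
      where
      module RX = Regular RX
      module RY = Regular RY
      instance
        m≢0 : NonZero m
        m≢0 = RX.n≢0
        n≢0 : NonZero n
        n≢0 = RY.n≢0
        mn≢0 : NonZero (m * n)
        mn≢0 = m*n≢0 m n
      Over : Point × Point → Set
      Over (x , y) = fp x ≡ X × fp y ≡ Y
      joined : ∀ p → Over p → Σ[ g ∈ Line ] fl g ≡ l × (fp (proj₁ p) ≡ X × proj₁ p ∈ g) × (fp (proj₂ p) ≡ Y × proj₂ p ∈ g)
      joined (x , y) (refl , refl) = let g , xg , yg = ax1 x y in
        g , join-unique X≢Y (pres x g xg) (pres y g yg) Xl Yl , (refl , xg) , (refl , yg)
      total : (m * n) * (m * n) ≡ N * (m * n)
      total = trans ([m*n]*[o*p]≡[m*o]*[n*p] m n m n) (exactly-unique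
        (exactly-× {P = λ x → fp x ≡ X} {Q = λ y → fp y ≡ Y} (RX.pt , RX.pt-enum) (RY.pt , RY.pt-enum))
        (exactly-fibres {R = λ g p → (fp (proj₁ p) ≡ X × proj₁ p ∈ g) × (fp (proj₂ p) ≡ Y × proj₂ p ∈ g)} over
          (λ { g refl → exactly-× (RX.onLineH g Xl) (RY.onLineH g Yl) })
          joined
          (λ { _ _ _ ((x~ , _) , (y~ , _)) → x~ , y~ })
          (λ { _ _ _ ((x~ , xg) , (y~ , yg)) ((_ , xh) , (_ , yh)) →
            joinᴴ-unique (λ eq → X≢Y (trans (sym x~) (trans eq y~))) xg xh yg yh })))

    order : ℕ
    order = proj₁ (regular (proj₁ nondeg))

    -- For a third point `Z` on the line `XY`, the lines over it number both `n_X n_Z` and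
    -- `n_Y n_Z`; cancel `n_Z`.
    order-constant : ∀ X Y → proj₁ (regular X) ≡ proj₁ (regular Y)
    order-constant X Y with X ≟ᴾ Y
    ... | yes refl = refl
    ... | no X≢Y with joinᴾ X Y
    ... | l , Xl , Yl with third-point l X Y
    ... | Z , Zl , Z≢X , Z≢Y = *-cancelʳ-≡ _ _ _ ⦃ Regular.n≢0 (proj₂ (regular Z)) ⦄ (exactly-unique
      (over-count (Z≢X ∘ sym) Xl Zl (proj₂ (regular X)) (proj₂ (regular Z)))
      (over-count (Z≢Y ∘ sym) Yl Zl (proj₂ (regular Y)) (proj₂ (regular Z))))

    abstract
      m : ℕ
      m = order

      R : ∀ X → Regular X m
      R X = subst (Regular X) (order-constant X (proj₁ nondeg)) (proj₂ (regular X))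

    module R X = Regular (R X)

    instance
      m≢0 : NonZero m
      m≢0 = Regular.n≢0 (R (proj₁ nondeg))

    lines-over : ∀ l → ExactlyOf (λ g → fl g ≡ l) (m * m)
    lines-over l with two-points l
    ... | X , Y , X≢Y , Xl , Yl = over-count X≢Y Xl Yl (R X) (R Y)

    -- The opaque copies over and labels keep with-abstraction from unfolding the enumerations.
    abstract
      over : ∀ l → ExactlyOf (λ g → fl g ≡ l) (m * m)
      over = lines-over

    -- The multiplicity of restrictions equals the order.

    restrictions : ∀ x g → fp x ∈ᴾ fl g → ExactlyOf (SameAt (fp x) g) (multiplicity x)
    restrictions x g xg =
      exactly-⇔ (λ h r y y~ → proj₂ (r (y , y~)) , proj₁ (r (y , y~)))
        (λ h s (y , y~) → proj₂ (s y y~) , proj₁ (s y y~))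
        (proj₂ (proj₂ (uniform x)) (g , lift g xg))

    -- `k` is the multiplicity at `X`, given by its defining property instead of through a point
    -- over `X`.
    module _ (X : Pointᴾ) {k : ℕ} (mult : ∀ g → X ∈ᴾ fl g → ExactlyOf (SameAt X g) k) where

      SameAt-∈ : ∀ {g h} → X ∈ᴾ fl g → SameAt X g h → X ∈ᴾ fl h
      SameAt-∈ Xg s = subst (X ∈ᴾ_) (SameAt⇒fl≡ Xg s) Xg

      pencilᴾ : Σ[ r ∈ ℕ ] ExactlyOf (X ∈ᴾ_) r
      pencilᴾ = count (proj₂ finLineᴾ) (X ∈ᴾ?_)

      r : ℕ
      r = proj₁ pencilᴾ

      -- The lines of `H` meeting the neighbourhood of `X` are grouped first by restriction, then by
      -- image.
      double-count : (m * m + m) * k ≡ r * (m * m)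
      double-count = exactly-unique
        (exactly-fibres {P = λ g → X ∈ᴾ fl g} {R = λ j g → SameAt X (R.ln X j) g} (counted-Fin _)
          (λ j _ → mult _ (R.through X j))
          (λ g Xg → let j , s = R.ln-index X g Xg in j , tt , s)
          (λ j g _ s → SameAt-∈ (R.through X j) s)
          (λ j j′ g s t → proj₁ (R.ln-enum X) j j′ (SameAt-trans s (SameAt-sym X _ _ t))))
        (exactly-fibres (proj₂ pencilᴾ) (λ l _ → over l)
          (λ g Xg → fl g , Xg , refl) (λ { _ _ Xl refl → Xl }) (λ { _ _ _ refl refl → refl }))

      reduced : suc m * k ≡ r * m
      reduced = *-cancelʳ-≡ _ _ m (trans rearrange (trans double-count (sym (*-assoc r m m))))
        where
        rearrange : (suc m * k) * m ≡ (m * m + m) * k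
        rearrange = trans (*-comm (suc m * k) m) (trans (sym (*-assoc m (suc m) k))
          (cong (_* k) (trans (*-comm m (suc m)) (+-comm m (m * m)))))

      class-count : ∀ g → X ∈ᴾ fl g → ExactlyOf (λ h → X ∈ᴾ fl h × ParallelAt X g h) (m * k)
      class-count g Xg with R.ln-index X g Xg
      ... | i , s = exactly-fibres {R = λ j h → SameAt X (R.ln X j) h} (R.inClass X i)
        (λ j _ → mult _ (R.through X j))
        (λ h (Xh , gh) → let j , t = R.ln-index X h Xh in
          j , R.parallel⇐ X i j (transport s (SameAt-sym X _ _ t) gh) , t)
        (λ j h ij t → SameAt-∈ (R.through X j) t , transport (SameAt-sym X _ _ s) t (R.parallel⇒ X i j ij))
        (λ j j′ h t t′ → proj₁ (R.ln-enum X) j j′ (SameAt-trans t (SameAt-sym X _ _ t′)))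
        where
        transport : ∀ {a b c d} → SameAt X a b → SameAt X c d → ParallelAt X b c → ParallelAt X a d
        transport ab cd (inj₁ bc) = inj₁ (SameAt-trans ab (SameAt-trans bc cd))
        transport ab cd (inj₂ bc) = inj₂ λ x x~ (xa , xd) → bc x x~ (proj₁ (ab x x~) xa , proj₂ (cd x x~) xd)

      k≡m : k ≡ m
      k≡m with joinᴾ X X
      ... | l , Xl , _ with flSurj l
      ... | g , refl = ≤-antisym
        -- All `m * k` lines restricting into the parallel class of `g` are among the `m * m` lines
        -- over `fl g`.
        (*-cancelˡ-≤ m (exactly-≤ (λ h (Xh , gh) → sym (ParallelAt⇒fl≡ Xl Xh gh)) (class-count g Xl) (over (fl g))))
        -- From `m * k + k ≡ r * m` it follows that `m` divides `k`, which is nonzero because `g`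
        -- has its own restriction.
        (∣⇒≤ ⦃ k≢0 (mult g Xl) ⦄ (∣m+n∣m⇒∣n (divides r (trans (+-comm (m * k) k) reduced)) (m∣m*n k)))
        where
        k≢0 : ∀ {k} → ExactlyOf (SameAt X g) k → NonZero k
        k≢0 {zero} (_ , _ , _ , cov) with cov g (SameAt-refl X g)
        ... | () , _
        k≢0 {suc k} _ = _

      r≡1+m : r ≡ suc m
      r≡1+m = sym (*-cancelʳ-≡ _ _ m (trans (cong (suc m *_) (sym k≡m)) reduced))

    multiplicity≥2 : ∀ x → 2 ≤ multiplicity x
    multiplicity≥2 x = subst (2 ≤_) (sym (k≡m (fp x) (restrictions x))) (R.2≤n (fp x))

    pencil-count : ∀ X → ExactlyOf (X ∈ᴾ_) (suc m)
    pencil-count X with fpSurj X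
    ... | x , refl = subst (ExactlyOf _) (r≡1+m (fp x) (restrictions x)) (proj₂ (pencilᴾ (fp x) (restrictions x)))

    -- Parallel classes from images, and the size of the image plane.

    fl≡⇒ParallelAt : ∀ {X g h} → X ∈ᴾ fl g → fl h ≡ fl g → ParallelAt X g h
    fl≡⇒ParallelAt {X} {g} {h} Xg eq with fpSurj X
    -- Since `k` is `m`, the class of `g` accounts for `m * m` lines over `fl g`, which is all of
    -- them.
    ... | x , refl = proj₂ (exactly-full (counted-≟ finLine)
        (λ h (xh , gh) → sym (ParallelAt⇒fl≡ Xg xh gh))
        (subst (λ k → ExactlyOf (λ h → fp x ∈ᴾ fl h × ParallelAt (fp x) g h) (m * k)) (k≡m (fp x) (restrictions x))
          (class-count (fp x) (restrictions x) g Xg))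
        (over (fl g)) h eq)

    fl≡⇒SameAt : ∀ {X g h x} → fl h ≡ fl g → fp x ≡ X → x ∈ g → x ∈ h → SameAt X g h
    fl≡⇒SameAt {g = g} {x = x} eq refl xg xh with fl≡⇒ParallelAt (pres x g xg) eq
    ... | inj₁ s = s
    ... | inj₂ d = contradiction (xg , xh) (d x refl)

    off-line : ∀ l → Σ[ X ∈ Pointᴾ ] ¬ X ∈ᴾ l
    off-line l with nondeg
    ... | A , B , C , _ , ¬ABC , _ with A ∈ᴾ? l | B ∈ᴾ? l | C ∈ᴾ? l
    ... | no A∉ | _     | _     = A , A∉
    ... | yes _ | no B∉ | _     = B , B∉
    ... | yes _ | yes _ | no C∉ = C , C∉
    ... | yes a | yes b | yes c = contradiction (l , a , b , c) ¬ABC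

    -- Projection from a point off `l` matches the points of `l` with the lines through that point.
    range-count : ∀ l → ExactlyOf (_∈ᴾ l) (suc m)
    range-count l with off-line l
    ... | X , X∉l = exactly-correspond (λ k Y → Y ∈ᴾ k)
      (λ k Xk → let Y , Yl , Yk = meetᴾ l k in Y , Yl , Yk)
      (λ Y Yl → let k , Xk , Yk = joinᴾ X Y in k , Xk , Yk)
      (λ k Y Z Xk Yl Zl Yk Zk → meet-unique (λ { refl → X∉l Xk }) Yl Yk Zl Zk)
      (λ k k′ Y Xk Xk′ Yl Yk Yk′ → join-unique (λ { refl → X∉l Yl }) Xk Yk Xk′ Yk′)
      (pencil-count X)

    -- The restrictions at `X` of the lines over `l` form a single parallel class, which has `m`
    -- members.
    over-class : ∀ X l → X ∈ᴾ l → ExactlyOf (λ j → fl (R.ln X j) ≡ l) m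
    over-class X l Xl with flSurj l
    ... | g , refl with R.ln-index X g Xl
    ... | i , s = exactly-⇔
      (λ j ij → trans (sym (ParallelAt⇒fl≡ (R.through X i) (R.through X j) (R.parallel⇒ X i j ij))) i≡g)
      (λ j j≡g → R.parallel⇐ X i j (fl≡⇒ParallelAt (R.through X i) (trans j≡g (sym i≡g))))
      (R.inClass X i)
      where
      i≡g : fl (R.ln X i) ≡ fl g
      i≡g = SameAt⇒fl≡ (R.through X i) s

    abstract
      pointsᴾ : Counted Pointᴾ (NP m)
      pointsᴾ = plane-size _≟ᴾ_ A (pencil-count A) range-count (λ X _ → joinᴾ A X)
        (λ X l k X≢A Al Ak Xl Xk → join-unique X≢A Xl Al Xk Ak)
        where
        A : Pointᴾ
        A = proj₁ nondeg

      linesᴾ : Counted Lineᴾ (NP m)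
      linesᴾ = plane-size _≟ᴸ_ k (range-count k) pencil-count
        (λ l _ → let X , Xk , Xl = meetᴾ k l in X , Xk , Xl)
        (λ l X Y l≢k Xk Yk Xl Yl → meet-unique l≢k Xl Xk Yl Yk)
        where
        k : Lineᴾ
        k = proj₁ (joinᴾ (proj₁ nondeg) (proj₁ nondeg))

      labels : ∀ X l → X ∈ᴾ l → ExactlyOf (λ j → fl (R.ln X j) ≡ l) m
      labels = over-class

    -- The input of the algorithm.

    P : Fin (NP m) → Pointᴾ
    P = proj₁ pointsᴾ

    L : Fin (NP m) → Lineᴾ
    L = proj₁ linesᴾ

    P-inj : ∀ i j → P i ≡ P j → i ≡ j
    P-inj = proj₁ (proj₂ pointsᴾ)

    L-inj : ∀ i j → L i ≡ L j → i ≡ j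
    L-inj = proj₁ (proj₂ linesᴾ)

    P-surj : ∀ X → Σ[ i ∈ Fin (NP m) ] P i ≡ X
    P-surj X = proj₂ (proj₂ (proj₂ pointsᴾ)) X tt

    L-surj : ∀ l → Σ[ i ∈ Fin (NP m) ] L i ≡ l
    L-surj l = proj₂ (proj₂ (proj₂ linesᴾ)) l tt

    Πₘ : IncStr
    Πₘ = mkInc (Fin (NP m)) (Fin (NP m)) (λ i l → P i ∈ᴾ L l)

    Πₘ-projective : IsProjectivePlane Πₘ
    Πₘ-projective = record { join = joinₘ ; meet = meetₘ ; nondeg = nondegₘ }
      where
      joinₘ : ∀ i j → i ≢ j → Σ[ l ∈ Fin (NP m) ] (P i ∈ᴾ L l × P j ∈ᴾ L l
        × (∀ k → P i ∈ᴾ L k → P j ∈ᴾ L k → k ≡ l))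
      joinₘ i j i≢j with joinᴾ (P i) (P j)
      ... | l , p , q with L-surj l
      ... | l , refl = l , p , q , λ k p′ q′ → L-inj k l (join-unique (i≢j ∘ P-inj i j) p′ q′ p q)
      meetₘ : ∀ l k → l ≢ k → Σ[ i ∈ Fin (NP m) ] (P i ∈ᴾ L l × P i ∈ᴾ L k
        × (∀ j → P j ∈ᴾ L l → P j ∈ᴾ L k → j ≡ i))
      meetₘ l k l≢k with meetᴾ (L l) (L k)
      ... | X , p , q with P-surj X
      ... | i , refl = i , p , q , λ j p′ q′ → P-inj j i (meet-unique (l≢k ∘ L-inj l k) p′ q′ p q)
      nondegₘ : Σ[ a ∈ Fin (NP m) ] Σ[ b ∈ Fin (NP m) ] Σ[ c ∈ Fin (NP m) ] Σ[ d ∈ Fin (NP m) ]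
        (¬ Collinear Πₘ a b c × ¬ Collinear Πₘ a b d × ¬ Collinear Πₘ a c d × ¬ Collinear Πₘ b c d)
      nondegₘ with nondeg
      ... | A , B , C , D , abc , abd , acd , bcd with P-surj A | P-surj B | P-surj C | P-surj D
      ... | a , refl | b , refl | c , refl | d , refl = a , b , c , d
        , (λ (l , p) → abc (L l , p)) , (λ (l , p) → abd (L l , p))
        , (λ (l , p) → acd (L l , p)) , (λ (l , p) → bcd (L l , p))

    abstract
      columns : ∀ l → ExactlyOf (λ i → P i ∈ᴾ L l) (suc m)
      columns l = exactly-correspond (λ X i → P i ≡ X)
        (λ X Xl → let i , eq = P-surj X in i , subst (_∈ᴾ L l) (sym eq) Xl , eq)
        (λ i il → P i , il , refl)
        (λ X i j _ _ _ p q → P-inj i j (trans p (sym q)))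
        (λ { _ _ _ _ _ _ refl refl → refl })
        (range-count (L l))

    col : Fin (NP m) → Fin (suc m) → Fin (NP m)
    col l = proj₁ (columns l)

    Pcol : Fin (NP m) → Fin (suc m) → Pointᴾ
    Pcol l j = P (col l j)

    col-on : ∀ l j → Pcol l j ∈ᴾ L l
    col-on l = proj₁ (proj₂ (proj₂ (columns l)))

    -- The parallel class assigned to `l` at a column consists of the restrictions there of the
    -- lines over `L l`; its symbols are positions in their enumeration.
    lab : Fin (NP m) → Fin (suc m) → Fin m → Fin (m * m + m)
    lab l j = proj₁ (labels (Pcol l j) (L l) (col-on l j))

    labLine : Fin (NP m) → Fin (suc m) → Fin m → Line
    labLine l j s = R.ln (Pcol l j) (lab l j s)

    labLine-over : ∀ l j s → fl (labLine l j s) ≡ L l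
    labLine-over l j = proj₁ (proj₂ (proj₂ (labels (Pcol l j) (L l) (col-on l j))))

    labLine-inj : ∀ l j s t → SameAt (Pcol l j) (labLine l j s) (labLine l j t) → s ≡ t
    labLine-inj l j s t same = proj₁ (proj₂ (labels (Pcol l j) (L l) (col-on l j))) s t
      (proj₁ (R.ln-enum (Pcol l j)) _ _ same)

    labLine-surj : ∀ l j g → fl g ≡ L l → Σ[ s ∈ Fin m ] SameAt (Pcol l j) (labLine l j s) g
    labLine-surj l j g eq with R.ln-index (Pcol l j) g (subst (Pcol l j ∈ᴾ_) (sym eq) (col-on l j))
    ... | i , same with proj₂ (proj₂ (proj₂ (labels (Pcol l j) (L l) (col-on l j)))) i
                          (trans (SameAt⇒fl≡ (R.through (Pcol l j) i) same) eq)
    ... | s , refl = s , same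

    row : Fin (NP m) → Fin (m * m) → Line
    row l = proj₁ (over (L l))

    row-over : ∀ l r → fl (row l r) ≡ L l
    row-over l = proj₁ (proj₂ (proj₂ (over (L l))))

    row-surj : ∀ l g → fl g ≡ L l → Σ[ r ∈ Fin (m * m) ] row l r ≡ g
    row-surj l = proj₂ (proj₂ (proj₂ (over (L l))))

    symbol : Fin (NP m) → Fin (m * m) → Fin (suc m) → Fin m
    symbol l r j = proj₁ (labLine-surj l j (row l r) (row-over l r))

    symbol-same : ∀ l r j → SameAt (Pcol l j) (labLine l j (symbol l r j)) (row l r)
    symbol-same l r j = proj₂ (labLine-surj l j (row l r) (row-over l r))

    -- Pick `x` on the restriction labelled `a` and `y` on the one labelled `b`. A line over `L l`
    -- has these two entries iff it contains `x` and `y`, and these points have exactly one join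
    -- because their images differ.
    symbol-isOA : ∀ l → IsOA m (symbol l)
    symbol-isOA l j k j≢k a b
      with lift (labLine l j a) (R.through (Pcol l j) (lab l j a))
         | lift (labLine l k b) (R.through (Pcol l k) (lab l k b))
    ... | x , x~ , xa | y , y~ , yb = found (ax1 x y)
      where
      x≁y : fp x ≢ fp y
      x≁y eq = j≢k (proj₁ (proj₂ (columns l)) j k (P-inj _ _ (trans (sym x~) (trans eq y~))))
      -- Two lines over `L l` that share a point over the column have the same restriction there,
      -- hence the same label.
      hits : ∀ i {s z} r → fp z ≡ Pcol l i → z ∈ labLine l i s → z ∈ row l r → symbol l r i ≡ s
      hits i {s} {z} r z~ zs zr = labLine-inj l i _ _ (SameAt-trans (symbol-same l r i)
        (fl≡⇒SameAt (trans (labLine-over l i s) (sym (row-over l r))) z~ zr zs))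
      onRow : ∀ i {s z} r → fp z ≡ Pcol l i → z ∈ labLine l i s → symbol l r i ≡ s → z ∈ row l r
      onRow i r z~ zs refl = proj₁ (symbol-same l r i _ z~) zs
      found : Σ[ g ∈ Line ] (x ∈ g × y ∈ g) →
        Σ[ r ∈ Fin (m * m) ] ((symbol l r j ≡ a × symbol l r k ≡ b)
          × (∀ r′ → symbol l r′ j ≡ a → symbol l r′ k ≡ b → r′ ≡ r))
      found (g , xg , yg) with row-surj l g (join-unique x≁y (pres x g xg) (pres y g yg)
                                 (subst (_∈ᴾ L l) (sym x~) (col-on l j)) (subst (_∈ᴾ L l) (sym y~) (col-on l k)))
      ... | r , refl = r , (hits j r x~ xa xg , hits k r y~ yb yg) , λ r′ p q →
        proj₁ (proj₂ (over (L l))) r′ r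
          (joinᴴ-unique x≁y (onRow j r′ x~ xa p) xg (onRow k r′ y~ yb q) yg)

    input : AlgInput m
    input = record
      { PI        = λ i l → P i ∈ᴾ L l
      ; projPlane = Πₘ-projective
      ; projOrder = columns
      ; AI        = λ i a b → R.pt (P i) a ∈ R.ln (P i) b
      ; affPlanes = λ i → record
          { affine = frame-affine (R.frameₙ (P i)) ; simple = R.simple (P i) ; order = R.onLine (P i) }
      ; OA        = symbol
      ; isOA      = symbol-isOA
      ; col       = col
      ; colBij    = λ l → proj₂ (columns l)
      ; lab       = lab
      ; labClass  = λ l j →
          proj₁ (proj₂ (labels (Pcol l j) (L l) (col-on l j)))
        , (λ s t → R.parallel⇐ (Pcol l j) _ _ (fl≡⇒ParallelAt (R.through (Pcol l j) _)
            (trans (labLine-over l j t) (sym (labLine-over l j s)))))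
        , (λ K s par → proj₂ (proj₂ (proj₂ (labels (Pcol l j) (L l) (col-on l j)))) K
            (trans (parallel⇒fl≡ (col l j) par) (labLine-over l j s)))
      -- Parallel restrictions have the same image, so parallel labels force `L l ≡ L k`; the
      -- `subst` moves the second label to the shared point.
      ; labDist   = λ l k i j l≢k eq s t par → l≢k (L-inj l k (trans (sym (labLine-over l i s))
          (trans (parallel⇒fl≡ (col l i) par)
            (subst (λ c → fl (R.ln (P c) (lab k j t)) ≡ L k) (sym eq) (labLine-over k j t))))) }
      where
      parallel⇒fl≡ : ∀ i {K K′} → Parallel (R.plane (P i)) K K′ → fl (R.ln (P i) K) ≡ fl (R.ln (P i) K′)
      parallel⇒fl≡ i par = ParallelAt⇒fl≡ (R.through (P i) _) (R.through (P i) _) (R.parallel⇒ (P i) _ _ par)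

    -- The isomorphism with the output of the algorithm.

    iso : Iso H (algOutput input)
    iso = record
      { pts = bijection point point-inj point-surj
      ; lns = bijection line line-inj line-surj
      -- Replacing `x` and `g` by the values of `point` and `line` at their indices reduces
      -- incidence to a statement about indices.
      ; inc = λ x g → subst₂
          (λ y h → (y ∈ h → IncStr._I_ (algOutput input) (proj₁ (point-surj x)) (proj₁ (line-surj g)))
                 × (IncStr._I_ (algOutput input) (proj₁ (point-surj x)) (proj₁ (line-surj g)) → y ∈ h))
          (proj₂ (point-surj x)) (proj₂ (line-surj g))
          (incidence (proj₁ (point-surj x)) (proj₁ (line-surj g))) }
      where
      point : Fin (NP m) × Fin (m * m) → Point
      point (i , a) = R.pt (P i) a
      line : Fin (NP m) × Fin (m * m) → Line
      line (l , r) = row l r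
      point-inj : ∀ p q → point p ≡ point q → p ≡ q
      point-inj (i , a) (j , b) eq with P-inj i j (trans (sym (R.near (P i) a)) (trans (cong fp eq) (R.near (P j) b)))
      ... | refl = cong (i ,_) (proj₁ (R.pt-enum (P i)) a b eq)
      point-surj : ∀ x → Σ[ p ∈ Fin (NP m) × Fin (m * m) ] point p ≡ x
      point-surj x with P-surj (fp x)
      ... | i , eq = let a , p = R.pt-index (P i) x (sym eq) in (i , a) , p
      line-inj : ∀ p q → line p ≡ line q → p ≡ q
      line-inj (l , r) (k , t) eq with L-inj l k (trans (sym (row-over l r)) (trans (cong fl eq) (row-over k t)))
      ... | refl = cong (l ,_) (proj₁ (proj₂ (over (L l))) r t eq)
      line-surj : ∀ g → Σ[ p ∈ Fin (NP m) × Fin (m * m) ] line p ≡ g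
      line-surj g with L-surj (fl g)
      ... | l , eq = let r , p = row-surj l g (sym eq) in (l , r) , p
      incidence : ∀ p q → (point p ∈ line q → IncStr._I_ (algOutput input) p q)
                        × (IncStr._I_ (algOutput input) p q → point p ∈ line q)
      incidence (i , a) (l , r) = to , from
        where
        to : R.pt (P i) a ∈ row l r → IncStr._I_ (algOutput input) (i , a) (l , r)
        -- The image of the point lies on `L l`, so it is one of the columns.
        to x∈ with proj₂ (proj₂ (proj₂ (columns l))) i
                     (subst₂ _∈ᴾ_ (R.near (P i) a) (row-over l r) (pres _ _ x∈))
        ... | j , refl = j , refl , proj₂ (symbol-same l r j _ (R.near (P i) a)) x∈
        from : IncStr._I_ (algOutput input) (i , a) (l , r) → R.pt (P i) a ∈ row l r
        from (j , refl , x∈) = proj₁ (symbol-same l r j _ (R.near (P i) a)) x∈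

theorem2 : (H Π : IncStr) (φ : Epi H Π) →
    Finite H →
    Simple H →
    IsPHP H Π φ →
    TwoUniform H Π φ →
    Σ[ m ∈ ℕ ] Σ[ D ∈ AlgInput m ] Iso H (algOutput D)
theorem2 H Π φ finite _ php uniform = m , input , iso
  where
  open Hjelmslev H Π φ finite php uniform
  open Epi φ
  discrete : (∀ x y → Dec (fp x ≡ fp y)) → DecidableEquality (IncStr.Point Π)
  discrete dec X Y with fpSurj X | fpSurj Y
  ... | x , refl | y , refl = dec x y
  ¬¬dec : {A : Set} → ¬ ¬ Dec A
  ¬¬dec ¬d = ¬d (no (¬d ∘ yes))
  2≤multiplicity : ∀ x → 2 ≤ multiplicity x
  -- The inequality is decidable, hence stable, so its proof may assume a decidable neighbour
  -- relation.
  2≤multiplicity x = decidable-stable (2 ≤? multiplicity x) λ ≱2 →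
    counted-¬¬ finPoint (λ y → counted-¬¬ finPoint λ z → ¬¬dec)
      λ dec → ≱2 (Discrete.multiplicity≥2 (discrete dec) x)
  -- The bound now makes the neighbour relation decidable outright, so the construction can be run
  -- without a double negation.
  open Discrete (discrete (near-dec 2≤multiplicity)) using (m; input; iso)
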